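{- For every index $\boldsymbol{k}$ and every $\bullet\in\{\emptyset,\star\}$, \[\overline{\zeta}^\bullet_{\widehat{\mathcal{Q}}}(\boldsymbol{k})=(-q^{ -\boldsymbol{p}})^{\mathrm{wt}(\boldsymbol{k})}(q^{\boldsymbol{p}})^{\mathrm{dep}(\boldsymbol{k})}\sum_{\boldsymbol{l}\in\mathbb{Z}_{\ge0}^{\mathrm{dep}(\boldsymbol{k})}}(q^{ -\boldsymbol{p}}[\boldsymbol{p}])^{\mathrm{wt}(\boldsymbol{l})}\,b\binom{\boldsymbol{k}}{\boldsymbol{l}}\,\zeta^\bullet_{\widehat{\mathcal{Q}}}(\overline{\boldsymbol{k}+\boldsymbol{l}})\] in $\widehat{\mathcal{Q}}$.
   Context: Indices. An index is $\boldsymbol{k}=(k_1,\dots,k_d)$ with $k_i$ positive integers (possibly empty; functions of indices equal $1$ on it). $\mathrm{wt}(\boldsymbol{k})=\sum k_i$ and $\mathrm{dep}(\boldsymbol{k})=d$. For $\boldsymbol{l}=(l_1,\dots,l_d)\in\mathbb{Z}_{\ge0}^d$: $\boldsymbol{k}+\boldsymbol{l}$ is the componentwise sum, $\mathrm{wt}(\boldsymbol{l})=\sum l_i$, $b\binom{\boldsymbol{k}}{\boldsymbol{l}}=\prod_{j=1}^d\binom{k_j+l_j-1}{l_j}$, and $\overline{(k_1,\dots,k_d)}=(k_d,\dots,k_1)$. $q$-sums. Let $[n]=(1-q^n)/(1-q)$, \[H_m(\boldsymbol{k};q)=\sum_{m\ge m_1>\cdots>m_d>0}\prod_a\frac{q^{(k_a-1)m_a}}{[m_a]^{k_a}},\qquad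 \overline{H}_m(\boldsymbol{k};q)=\sum_{m\ge m_1>\cdots>m_d>0}\prod_a\frac{q^{m_a}}{[m_a]^{k_a}},\] with star versions summed over $m\ge m_1\ge\cdots\ge m_d>0$. The ring $\widehat{\mathcal{Q}}$. For a prime $p$, $\mathbb{Z}_{(p)}$ is the set of rationals whose denominator is prime to $p$, and $Z_{p,n}=\mathbb{Z}_{(p)}[q]/([p]^n)$. Set $\mathcal{Q}_n=(\prod_pZ_{p,n})/(\bigoplus_pZ_{p,n})$ and $\widehat{\mathcal{Q}}=\varprojlim_n\mathcal{Q}_n$; here $[m]$ is invertible in $Z_{p,n}$ for $1\le m<p$. Define \[\zeta^\bullet_{\widehat{\mathcal{Q}}}(\boldsymbol{k})=((H^\bullet_{p-1}(\boldsymbol{k};q)\bmod[p]^n)_p)_n,\qquad \overline{\zeta}^\bullet_{\widehat{\mathcal{Q}}}(\boldsymbol{k})=((\overline{H}^\bullet_{p-1}(\boldsymbol{k};q)\bmod[p]^n)_p)_n.\] Put $[\boldsymbol{p}]=(([p]\bmod[p]^n)_p)_n$ and $q^{\boldsymbol{p}}=((q^p\bmod[p]^n)_p)_n=1-(1-q)[\boldsymbol{p}]$. Its inverse is $q^{ -\boldsymbol{p}}=(((q^p)^{ -1}\bmod[p]^n)_p)_n=\sum_{l\ge0}((1-q)[\boldsymbol{p}])^l$. The ring $\widehat{\mathcal{Q}}$ is complete in the $[\boldsymbol{p}]$-adic topology. -}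

module Defs where

open import Data.Bool using (Bool; true; false; if_then_else_)
open import Data.Nat as ℕ using (ℕ; zero; suc; _∸_; _<?_)
open import Data.Nat.Divisibility using (_∣_)
open import Data.Nat.Combinatorics using (_C_)
open import Data.List using (List; []; _∷_; map; foldr; upTo; concatMap; filter; zipWith; reverse; length)
open import Data.Nat.ListAction using (sum; product)
open import Data.Rational as Q using (ℚ; 0ℚ; 1ℚ)
open import Data.Integer using (+_)
open import Data.Product using (Σ; _×_; _,_)
open import Relation.Binary.PropositionalEquality using (_≡_)
open import Relation.Nullary using (¬_)

-- Polynomials in q over ℚ, as coefficient lists (lowest degree first)

Poly : Set
Poly = List ℚ

fromℕQ : ℕ → ℚ
fromℕQ n = (+ n) Q./ 1

constP : ℚ → Poly
constP c = c ∷ []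

oneP : Poly
oneP = constP 1ℚ

addP : Poly → Poly → Poly
addP [] g = g
addP (a ∷ f) [] = a ∷ f
addP (a ∷ f) (b ∷ g) = (a Q.+ b) ∷ addP f g

scaleP : ℚ → Poly → Poly
scaleP c = map (c Q.*_)

negP : Poly → Poly
negP = map (λ a → Q.- a)

mulP : Poly → Poly → Poly
mulP [] g = []
mulP (a ∷ f) g = addP (scaleP a g) (0ℚ ∷ mulP f g)

powP : Poly → ℕ → Poly
powP f zero = oneP
powP f (suc n) = mulP f (powP f n)

X : Poly
X = 0ℚ ∷ 1ℚ ∷ []

qpow : ℕ → Poly
qpow n = powP X n

-- [m] = 1 + q + ... + q^(m-1) = (1 - q^m)/(1 - q)
bracket : ℕ → Poly
bracket m = foldr addP [] (map qpow (upTo m))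

coeff : Poly → ℕ → ℚ
coeff [] i = 0ℚ
coeff (a ∷ f) zero = a
coeff (a ∷ f) (suc i) = coeff f i

-- equality of polynomials (up to trailing zeros)
_≈P_ : Poly → Poly → Set
f ≈P g = ∀ i → coeff f i ≡ coeff g i

-- a ∈ ℤ_(p): denominator prime to p (Data.Rational is normalised)
InZp : ℕ → ℚ → Set
InZp p a = ¬ (p ∣ Q.ℚ.denominatorℕ a)

IntP : ℕ → Poly → Set
IntP p f = ∀ i → InZp p (coeff f i)

DivBy : ℕ → ℕ → Poly → Set
DivBy p n f = Σ Poly (λ g → IntP p g × (f ≈P mulP (powP (bracket p) n) g))

-- Fractions num/den; all fractions used below have numerators in ℤ[q]
-- and denominators products of [m] (1 ≤ m < p) and powers of q, hence
-- units in Z_{p,n} = ℤ_(p)[q]/([p]^n).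

Frac : Set
Frac = Poly × Poly

ofP : Poly → Frac
ofP f = f , oneP

oneF : Frac
oneF = ofP oneP

zeroF : Frac
zeroF = ofP []

addF : Frac → Frac → Frac
addF (a , b) (c , d) = addP (mulP a d) (mulP c b) , mulP b d

mulF : Frac → Frac → Frac
mulF (a , b) (c , d) = mulP a c , mulP b d

powF : Frac → ℕ → Frac
powF x zero = oneF
powF x (suc n) = mulF x (powF x n)

sumF : List Frac → Frac
sumF = foldr addF zeroF

-- equality in Z_{p,n} of a/b and c/d (b, d units): a d - c b ∈ [p]^n ℤ_(p)[q]
EqMod : ℕ → ℕ → Frac → Frac → Set
EqMod p n (a , b) (c , d) = DivBy p n (addP (mulP a d) (negP (mulP c b)))

-- finite q-multiple harmonic sums
-- star = false : m ≥ m₁ > m₂ > ... > m_d > 0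
-- star = true  : m ≥ m₁ ≥ m₂ ≥ ... ≥ m_d > 0
-- e k j : exponent of q in the numerator of the factor for (k_a , m_a) = (k , j)

Hgen : (ℕ → ℕ → ℕ) → Bool → ℕ → List ℕ → Frac
Hgen e s m [] = oneF
Hgen e s m (k ∷ ks) =
  sumF (map (λ j → mulF (qpow (e k j) , powP (bracket j) k)
                        (Hgen e s (if s then j else j ∸ 1) ks))
            (map suc (upTo m)))

H : Bool → ℕ → List ℕ → Frac
H = Hgen (λ k j → (k ∸ 1) ℕ.* j)

Hbar : Bool → ℕ → List ℕ → Frac
Hbar = Hgen (λ k j → j)

wt : List ℕ → ℕ
wt = sum

dep : List ℕ → ℕ
dep = length

bbin : List ℕ → List ℕ → ℕ
bbin k l = product (zipWith (λ kj lj → (kj ℕ.+ lj ∸ 1) C lj) k l)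

box : ℕ → ℕ → List (List ℕ)
box zero N = [] ∷ []
box (suc d) N = concatMap (λ i → map (i ∷_) (box d N)) (upTo N)

lowWt : ℕ → ℕ → List (List ℕ)
lowWt d N = filter (λ l → sum l <? N) (box d N)

qP : ℕ → Frac
qP p = ofP (qpow p)

qPinv : ℕ → Frac
qPinv p = oneP , qpow p

negqPinv : ℕ → Frac
negqPinv p = negP oneP , qpow p

-- p-component of the partial sum (over wt(l) < N) of the right-hand side
RHS : Bool → List ℕ → ℕ → ℕ → Frac
RHS s k p N =
  mulF (powF (negqPinv p) (wt k))
   (mulF (powF (qP p) (dep k))
     (sumF (map (λ l → mulF (powF (mulF (qPinv p) (ofP (bracket p))) (wt l))
                          (mulF (ofP (constP (fromℕQ (bbin k l))))
                                (H s (p ∸ 1) (reverse (zipWith ℕ._+_ k l)))))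
                (lowWt (dep k) N))))

{-# OPTIONS --safe #-}
module Submission where

-- Reflecting the summation variables, m ↦ p - m, reverses the chain of
-- inequalities, and [ p - m ] = - qᵖ⁻ᵐ ([ m ] - qᵐ⁻ᵖ [ p ]).  Hence each factor
-- qᵖ⁻ᵐ / [ p - m ]ᵏ is (- q⁻ᵖ)ᵏ qᵖ q⁽ᵏ⁻¹⁾ᵐ / [ m ]ᵏ times the binomial series
-- (1 - y)⁻ᵏ in y = q⁻ᵖ [ p ] qᵐ / [ m ], which is nilpotent modulo [ p ]ⁿ; expanding
-- the product of these series gives the claim.  Everything takes place in the
-- ring ℤ[q] / ([ p ]ⁿ), where q and the [ m ] with 0 < m < p are invertible, and
-- a fraction a / b is compared with its value v through a = v b.

open import Defs
open import Algebra.Bundles using (CommutativeRing)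
import Algebra.Properties.CommutativeSemiring.Exp as Exp
import Algebra.Properties.Ring as RingProperties
import Algebra.Properties.Semiring.Mult as Mult
import Algebra.Solver.Ring.NaturalCoefficients.Default as Solver
open import Data.Bool using (Bool; true; false; if_then_else_)
open import Data.Integer as ℤ using (ℤ; +_; 0ℤ; 1ℤ)
import Data.Integer.Properties as ℤ
open import Data.Integer.Solver using (module +-*-Solver)
open import Data.List using (List; []; _∷_; _++_; _∷ʳ_; map; upTo; applyUpTo; applyDownFrom; foldr; concatMap; filter; zipWith; reverse; length)
import Data.List.Properties as List
open import Data.List.Relation.Unary.All as All using (All; []; _∷_)
open import Data.List.Relation.Unary.All.Properties using (applyUpTo⁺₁)
open import Data.Nat as ℕ using (ℕ; zero; suc; s≤s; z≤n; _∸_; _≤_; _<_; _≤?_; _<?_)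
open import Data.Nat.Combinatorics using (_C_; nCk+nC[k+1]≡[n+1]C[k+1]; k>n⇒nCk≡0)
open import Data.Nat.Coprimality as Coprimality using (prime⇒coprime; coprime-Bézout)
open import Data.Nat.Divisibility using (∣1⇒≡1)
open import Data.Nat.GCD using (module Bézout)
open import Data.Nat.ListAction using (sum)
open import Data.Nat.Primality using (Prime; ¬prime[0]; ¬prime[1])
import Data.Nat.Properties as ℕ
open import Data.Product using (∃; ∃-syntax; _,_; proj₁; proj₂) renaming (_×_ to _∧_)
open import Data.Rational as ℚ using (ℚ; mkℚ)
import Data.Rational.Properties as ℚ
open import Data.Rational.Unnormalised using (*≡*)
import Data.Rational.Unnormalised.Properties as ℚᵘ
open import Function using (_∘_)
open import Level using (0ℓ; _⊔_)
open import Relation.Binary.PropositionalEquality as ≡ using (_≡_)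
open import Relation.Nullary using (¬_; yes; no; contradiction)
open import Relation.Nullary.Decidable using (_×-dec_)
open import Relation.Unary using (Pred; Decidable)

-- The units come from Bézout: for `0 < m < p` some multiples of `p` and `m` differ by 1, and
-- `[ b ]` divides `[ a b ]`, so a multiple of `[ m ]` equals 1 minus a multiple of the nilpotent
-- `[ p ]`, and a geometric series inverts it. The inverses thus exist with integer coefficients,
-- which is why ℤ[q] can stand in for the polynomials over the localisation at `p`.
--
-- The obstacle to reflecting the sums is that `Hgen` picks the largest variable first, whereas
-- after the reflection the smallest comes first. The sums are therefore rewritten as `chain`, a sum
-- over subsequences of an explicit list, where reversing the list together with the functions
-- changes nothing. Undoing the reflected order in this way is what reverses the index `k + l`.
--
-- The infinite sum over `l` enters only through partial sums: a term of weight at least `n`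
-- contains the factor `[ p ]ⁿ`, so modulo `[ p ]ⁿ` the partial sums are constant from that weight
-- on.

-- Finite sums in a commutative ring.

module Sums {c ℓ} (R : CommutativeRing c ℓ) where
  open CommutativeRing R
  open import Relation.Binary.Reasoning.Setoid setoid
  open Solver commutativeSemiring using (solve; _:=_; _:+_; _:*_; con)

  private variable
    I J : Set

  ∑ : List I → (I → Carrier) → Carrier
  ∑ []       f = 0#
  ∑ (i ∷ is) f = f i + ∑ is f

  ∑-cong : ∀ (is : List I) {f g} → All (λ i → f i ≈ g i) is → ∑ is f ≈ ∑ is g
  ∑-cong []       []       = refl
  ∑-cong (i ∷ is) (e ∷ es) = +-cong e (∑-cong is es)

  ∑-cong′ : ∀ (is : List I) {f g} → (∀ i → f i ≈ g i) → ∑ is f ≈ ∑ is g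
  ∑-cong′ is e = ∑-cong is (All.universal e is)

  ∑-zero : ∀ (is : List I) {f} → (∀ i → f i ≈ 0#) → ∑ is f ≈ 0#
  ∑-zero []       e = refl
  ∑-zero (i ∷ is) e = trans (+-cong (e i) (∑-zero is e)) (+-identityˡ 0#)

  ∑-+ : ∀ (is : List I) f g → ∑ is (λ i → f i + g i) ≈ ∑ is f + ∑ is g
  ∑-+ []       f g = sym (+-identityˡ 0#)
  ∑-+ (i ∷ is) f g = trans (+-congˡ (∑-+ is f g))
    (solve 4 (λ a b s t → (a :+ b) :+ (s :+ t) := (a :+ s) :+ (b :+ t)) refl (f i) (g i) (∑ is f) (∑ is g))

  ∑-*ˡ : ∀ (is : List I) x f → x * ∑ is f ≈ ∑ is (λ i → x * f i)
  ∑-*ˡ []       x f = zeroʳ x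
  ∑-*ˡ (i ∷ is) x f = trans (distribˡ x (f i) (∑ is f)) (+-congˡ (∑-*ˡ is x f))

  ∑-++ : ∀ (is js : List I) f → ∑ (is ++ js) f ≈ ∑ is f + ∑ js f
  ∑-++ []       js f = sym (+-identityˡ _)
  ∑-++ (i ∷ is) js f = trans (+-congˡ (∑-++ is js f)) (sym (+-assoc _ _ _))

  ∑-map : ∀ (h : I → J) is f → ∑ (map h is) f ≈ ∑ is (f ∘ h)
  ∑-map h []       f = refl
  ∑-map h (i ∷ is) f = +-congˡ (∑-map h is f)

  ∑-concatMap : ∀ (h : I → List J) is f → ∑ (concatMap h is) f ≈ ∑ is (λ i → ∑ (h i) f)
  ∑-concatMap h []       f = refl
  ∑-concatMap h (i ∷ is) f = trans (∑-++ (h i) _ f) (+-congˡ (∑-concatMap h is f))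

  ∑-filter : ∀ {P : Pred I 0ℓ} (P? : Decidable P) is {f} → (∀ i → ¬ P i → f i ≈ 0#) → ∑ (filter P? is) f ≈ ∑ is f
  ∑-filter P? []       e = refl
  ∑-filter P? (i ∷ is) e with P? i
  ... | yes _ = +-congˡ (∑-filter P? is e)
  ... | no ¬p = trans (∑-filter P? is e) (sym (trans (+-congʳ (e i ¬p)) (+-identityˡ _)))

  ∑-upTo-suc : ∀ n f → ∑ (upTo (suc n)) f ≈ ∑ (upTo n) f + f n
  ∑-upTo-suc n f = begin
    ∑ (upTo (suc n)) f              ≡⟨ ≡.cong (λ is → ∑ is f) (List.upTo-∷ʳ n) ⟨
    ∑ (upTo n ∷ʳ n) f               ≈⟨ ∑-++ (upTo n) (n ∷ []) f ⟩
    ∑ (upTo n) f + (f n + 0#)       ≈⟨ +-congˡ (+-identityʳ (f n)) ⟩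
    ∑ (upTo n) f + f n              ∎

-- Nested sums over subsequences of a list: reversal and multilinearity.

module Chains {c ℓ} (R : CommutativeRing c ℓ) where
  open CommutativeRing R
  open Sums R
  open import Relation.Binary.Reasoning.Setoid setoid
  open Solver commutativeSemiring using (solve; _:=_; _:+_; _:*_; con)

  private variable
    A K I : Set

  -- Sum of φ₁ x₁ ⋯ φ_d x_d over the subsequences x₁ , … , x_d of L (weakly
  -- increasing positions, i.e. with repetitions, if s = true).
  chain : Bool → List A → List (A → Carrier) → Carrier
  chain s L       []       = 1#
  chain s []      (φ ∷ φs) = 0#
  chain s (x ∷ L) (φ ∷ φs) = φ x * chain s (if s then x ∷ L else L) φs + chain s L (φ ∷ φs)

  -- The predicates `P` and `Q` restrict where the functions must agree, because the reflection
  -- identity is available only for positive entries and for variables between 1 and `r`.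
  chain-cong : ∀ s {Q : Pred K 0ℓ} {P : Pred A 0ℓ} (f g : K → A → Carrier) →
               (∀ {k x} → Q k → P x → f k x ≈ g k x) →
               ∀ {L ks} → All P L → All Q ks → chain s L (map f ks) ≈ chain s L (map g ks)
  chain-cong s f g e ps [] = refl
  chain-cong s f g e [] (q ∷ qs) = refl
  chain-cong false f g e (p ∷ ps) (q ∷ qs) =
    +-cong (*-cong (e q p) (chain-cong false f g e ps qs)) (chain-cong false f g e ps (q ∷ qs))
  chain-cong true f g e (p ∷ ps) (q ∷ qs) =
    +-cong (*-cong (e q p) (chain-cong true f g e (p ∷ ps) qs)) (chain-cong true f g e ps (q ∷ qs))

  chain-map : ∀ s (h : A → K) L (ks : List I) (f : I → K → Carrier) →
              chain s (map h L) (map f ks) ≈ chain s L (map (λ k → f k ∘ h) ks)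
  chain-map s h L [] f = refl
  chain-map s h [] (k ∷ ks) f = refl
  chain-map false h (x ∷ L) (k ∷ ks) f = +-cong (*-congˡ (chain-map false h L ks f)) (chain-map false h L (k ∷ ks) f)
  chain-map true h (x ∷ L) (k ∷ ks) f = +-cong (*-congˡ (chain-map true h (x ∷ L) ks f)) (chain-map true h L (k ∷ ks) f)

  chain-[]-∷ʳ : ∀ s (φs : List (A → Carrier)) φ → chain s [] (φs ∷ʳ φ) ≈ 0#
  chain-[]-∷ʳ s []       φ = refl
  chain-[]-∷ʳ s (_ ∷ φs) φ = refl

  -- Mirror image of the defining recursion: either the last function is evaluated at the last
  -- position or it avoids it. The induction peels the left ends of both lists, and peeling left
  -- commutes with peeling right.
  chain-∷ʳ : ∀ s L (x : A) φs φ → chain s (L ∷ʳ x) (φs ∷ʳ φ) ≈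
             chain s (if s then L ∷ʳ x else L) φs * φ x + chain s L (φs ∷ʳ φ)
  chain-∷ʳ false [] x [] φ = solve 1 (λ a → a :* con 1 :+ con 0 := con 1 :* a :+ con 0) refl (φ x)
  chain-∷ʳ true  [] x [] φ = solve 1 (λ a → a :* con 1 :+ con 0 := con 1 :* a :+ con 0) refl (φ x)
  chain-∷ʳ false [] x (ψ ∷ ψs) φ = begin
    ψ x * chain false [] (ψs ∷ʳ φ) + 0#  ≈⟨ +-congʳ (*-congˡ (chain-[]-∷ʳ false ψs φ)) ⟩
    ψ x * 0# + 0#                        ≈⟨ solve 2 (λ a b → a :* con 0 :+ con 0 := con 0 :* b :+ con 0) refl (ψ x) (φ x) ⟩
    0# * φ x + 0#                        ∎
  chain-∷ʳ true [] x (ψ ∷ ψs) φ = begin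
    ψ x * chain true (x ∷ []) (ψs ∷ʳ φ) + 0#                        ≈⟨ +-congʳ (*-congˡ (chain-∷ʳ true [] x ψs φ)) ⟩
    ψ x * (chain true (x ∷ []) ψs * φ x + chain true [] (ψs ∷ʳ φ)) + 0#  ≈⟨ +-congʳ (*-congˡ (+-congˡ (chain-[]-∷ʳ true ψs φ))) ⟩
    ψ x * (chain true (x ∷ []) ψs * φ x + 0#) + 0#                  ≈⟨ solve 3 (λ a b t → a :* (t :* b :+ con 0) :+ con 0 := (a :* t :+ con 0) :* b :+ con 0) refl (ψ x) (φ x) _ ⟩
    (ψ x * chain true (x ∷ []) ψs + 0#) * φ x + 0#                  ∎
  chain-∷ʳ false (y ∷ L) x [] φ = trans (+-congˡ (chain-∷ʳ false L x [] φ))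
    (solve 3 (λ a b t → a :* con 1 :+ (con 1 :* b :+ t) := con 1 :* b :+ (a :* con 1 :+ t)) refl (φ y) (φ x) _)
  chain-∷ʳ true (y ∷ L) x [] φ = trans (+-congˡ (chain-∷ʳ true L x [] φ))
    (solve 3 (λ a b t → a :* con 1 :+ (con 1 :* b :+ t) := con 1 :* b :+ (a :* con 1 :+ t)) refl (φ y) (φ x) _)
  chain-∷ʳ false (y ∷ L) x (ψ ∷ ψs) φ =
    trans (+-cong (*-congˡ (chain-∷ʳ false L x ψs φ)) (chain-∷ʳ false L x (ψ ∷ ψs) φ))
    (solve 6 (λ a b r s t u → a :* (r :* b :+ s) :+ (t :* b :+ u) := (a :* r :+ t) :* b :+ (a :* s :+ u)) refl (ψ y) (φ x) _ _ _ _)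
  chain-∷ʳ true (y ∷ L) x (ψ ∷ ψs) φ =
    trans (+-cong (*-congˡ (chain-∷ʳ true (y ∷ L) x ψs φ)) (chain-∷ʳ true L x (ψ ∷ ψs) φ))
    (solve 6 (λ a b r s t u → a :* (r :* b :+ s) :+ (t :* b :+ u) := (a :* r :+ t) :* b :+ (a :* s :+ u)) refl (ψ y) (φ x) _ _ _ _)

  -- Reversal exchanges the recursion at the left end with the one at the right end given by
  -- `chain-∷ʳ`; commutativity restores the order of the factors.
  chain-reverse : ∀ s (L : List A) φs → chain s (reverse L) (reverse φs) ≈ chain s L φs
  chain-reverse s L [] = refl
  chain-reverse s [] (φ ∷ φs) = trans (reflexive (≡.cong (chain s []) (List.unfold-reverse φ φs))) (chain-[]-∷ʳ s (reverse φs) φ)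
  chain-reverse s (x ∷ L) (φ ∷ φs) = begin
    chain s (reverse (x ∷ L)) (reverse (φ ∷ φs))
      ≡⟨ ≡.cong₂ (chain s) (List.unfold-reverse x L) (List.unfold-reverse φ φs) ⟩
    chain s (reverse L ∷ʳ x) (reverse φs ∷ʳ φ)
      ≈⟨ chain-∷ʳ s (reverse L) x (reverse φs) φ ⟩
    chain s (if s then reverse L ∷ʳ x else reverse L) (reverse φs) * φ x + chain s (reverse L) (reverse φs ∷ʳ φ)
      ≡⟨ ≡.cong₂ (λ M ψs → chain s M (reverse φs) * φ x + chain s (reverse L) ψs) (reverse-if s) (≡.sym (List.unfold-reverse φ φs)) ⟩
    chain s (reverse (if s then x ∷ L else L)) (reverse φs) * φ x + chain s (reverse L) (reverse (φ ∷ φs))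
      ≈⟨ +-cong (*-congʳ (chain-reverse s (if s then x ∷ L else L) φs)) (chain-reverse s L (φ ∷ φs)) ⟩
    chain s (if s then x ∷ L else L) φs * φ x + chain s L (φ ∷ φs)
      ≈⟨ +-congʳ (*-comm _ _) ⟩
    chain s (x ∷ L) (φ ∷ φs) ∎
    where
    reverse-if : ∀ s → (if s then reverse L ∷ʳ x else reverse L) ≡ reverse (if s then x ∷ L else L)
    reverse-if false = ≡.refl
    reverse-if true  = ≡.sym (List.unfold-reverse x L)

  chain-linear-head : ∀ s L is (a : I → Carrier) (f : I → A → Carrier) φs →
    chain s L ((λ x → ∑ is (λ i → a i * f i x)) ∷ φs) ≈ ∑ is (λ i → a i * chain s L (f i ∷ φs))
  chain-linear-head s [] is a f φs = sym (∑-zero is (λ i → zeroʳ (a i)))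
  chain-linear-head s (x ∷ L) is a f φs = begin
    ∑ is (λ i → a i * f i x) * t + chain s L ((λ x → ∑ is (λ i → a i * f i x)) ∷ φs)
      ≈⟨ +-cong (trans (*-comm _ t) (∑-*ˡ is t _)) (chain-linear-head s L is a f φs) ⟩
    ∑ is (λ i → t * (a i * f i x)) + ∑ is (λ i → a i * chain s L (f i ∷ φs))
      ≈⟨ ∑-+ is _ _ ⟨
    ∑ is (λ i → t * (a i * f i x) + a i * chain s L (f i ∷ φs))
      ≈⟨ ∑-cong′ is (λ i → solve 4 (λ t a u v → t :* (a :* u) :+ a :* v := a :* (u :* t :+ v)) refl t (a i) (f i x) _) ⟩
    ∑ is (λ i → a i * (f i x * t + chain s L (f i ∷ φs))) ∎
    where t = chain s (if s then x ∷ L else L) φs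

  -- The expansion of `φs` is assumed for all lists at once, since the recursion evaluates `φs` on a
  -- different list at each step.
  chain-linear-tail : ∀ s (φ : A → Carrier) φs is (a : I → Carrier) (ψs : I → List (A → Carrier)) →
    (∀ L → chain s L φs ≈ ∑ is (λ i → a i * chain s L (ψs i))) →
    ∀ L → chain s L (φ ∷ φs) ≈ ∑ is (λ i → a i * chain s L (φ ∷ ψs i))
  chain-linear-tail s φ φs is a ψs e [] = sym (∑-zero is (λ i → zeroʳ (a i)))
  chain-linear-tail s φ φs is a ψs e (x ∷ L) = begin
    φ x * chain s M φs + chain s L (φ ∷ φs)
      ≈⟨ +-cong (trans (*-congˡ (e M)) (∑-*ˡ is (φ x) _)) (chain-linear-tail s φ φs is a ψs e L) ⟩
    ∑ is (λ i → φ x * (a i * chain s M (ψs i))) + ∑ is (λ i → a i * chain s L (φ ∷ ψs i))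
      ≈⟨ ∑-+ is _ _ ⟨
    ∑ is (λ i → φ x * (a i * chain s M (ψs i)) + a i * chain s L (φ ∷ ψs i))
      ≈⟨ ∑-cong′ is (λ i → solve 4 (λ t a u v → t :* (a :* u) :+ a :* v := a :* (t :* u :+ v)) refl (φ x) (a i) _ _) ⟩
    ∑ is (λ i → a i * (φ x * chain s M (ψs i) + chain s L (φ ∷ ψs i))) ∎
    where M = if s then x ∷ L else L

  -- The expansion is linear in each function separately, so the coefficients multiply. The product
  -- `α` is given by its recursion only, which lets it be instantiated with the grouped form in
  -- terms of `wt`, `dep` and `bbin`.
  chain-multilinear : ∀ s N (f : ℕ → A → Carrier) (a : ℕ → ℕ → Carrier) (α : List ℕ → List ℕ → Carrier) →
    α [] [] ≈ 1# → (∀ k ks l ls → α (k ∷ ks) (l ∷ ls) ≈ a k l * α ks ls) →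
    ∀ ks L → chain s L (map (λ k x → ∑ (upTo N) (λ l → a k l * f (k ℕ.+ l) x)) ks) ≈
             ∑ (box (length ks) N) (λ ls → α ks ls * chain s L (map f (zipWith ℕ._+_ ks ls)))
  chain-multilinear s N f a α α[] α∷ [] L = begin
    1#                  ≈⟨ solve 0 (con 1 := con 1 :* con 1 :+ con 0) refl ⟩
    1# * 1# + 0#        ≈⟨ +-congʳ (*-congʳ α[]) ⟨
    α [] [] * 1# + 0#   ∎
  chain-multilinear s N f a α α[] α∷ (k ∷ ks) L = begin
    chain s L (φ k ∷ map φ ks)
      ≈⟨ chain-linear-head s L (upTo N) (a k) (λ l → f (k ℕ.+ l)) (map φ ks) ⟩
    ∑ (upTo N) (λ l → a k l * chain s L (f (k ℕ.+ l) ∷ map φ ks))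
      ≈⟨ ∑-cong′ (upTo N) (λ l → *-congˡ (chain-linear-tail s (f (k ℕ.+ l)) (map φ ks) B (α ks) (λ ls → map f (zipWith ℕ._+_ ks ls)) (chain-multilinear s N f a α α[] α∷ ks) L)) ⟩
    ∑ (upTo N) (λ l → a k l * ∑ B (λ ls → α ks ls * T l ls))
      ≈⟨ ∑-cong′ (upTo N) (λ l → trans (∑-*ˡ B (a k l) _) (∑-cong′ B (λ ls → trans (sym (*-assoc _ _ _)) (*-congʳ (sym (α∷ k ks l ls)))))) ⟩
    ∑ (upTo N) (λ l → ∑ B (λ ls → α (k ∷ ks) (l ∷ ls) * T l ls))
      ≈⟨ ∑-cong′ (upTo N) (λ l → ∑-map (l ∷_) B _) ⟨
    ∑ (upTo N) (λ l → ∑ (map (l ∷_) B) (λ ls → α (k ∷ ks) ls * chain s L (map f (zipWith ℕ._+_ (k ∷ ks) ls))))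
      ≈⟨ ∑-concatMap (λ l → map (l ∷_) B) (upTo N) _ ⟨
    ∑ (box (length (k ∷ ks)) N) (λ ls → α (k ∷ ks) ls * chain s L (map f (zipWith ℕ._+_ (k ∷ ks) ls))) ∎
    where
    φ = λ k x → ∑ (upTo N) (λ l → a k l * f (k ℕ.+ l) x)
    B = box (length ks) N
    T = λ l ls → chain s L (f (k ℕ.+ l) ∷ map f (zipWith ℕ._+_ ks ls))

-- Truncated binomial series at a nilpotent element.

module BinomialSeries {c ℓ} (R : CommutativeRing c ℓ) where
  open CommutativeRing R
  open Sums R
  open RingProperties ring using (+-cancelʳ)
  open Exp commutativeSemiring
  open Mult semiring using (_×_; ×-congˡ; ×-homo-+)
  open import Relation.Binary.Reasoning.Setoid setoid
  open Solver commutativeSemiring using (solve; _:=_; _:+_; _:*_; con)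

  ι : ℕ → Carrier
  ι n = n × 1#

  series : ℕ → ℕ → Carrier → Carrier
  series k N y = ∑ (upTo N) (λ l → ι ((k ℕ.+ l ∸ 1) C l) * y ^ l)

  -- At `k = 0` truncated subtraction gives the coefficient `0 C 0`, which is 1, and then
  -- `(l ∸ 1) C l`, which is 0 for positive `l`. The induction on exponents can therefore start at
  -- 0.
  series-0 : ∀ M y → series 0 (suc M) y ≈ 1#
  series-0 zero y = solve 0 ((con 1 :+ con 0) :* con 1 :+ con 0 := con 1) refl
  series-0 (suc M) y = begin
    series 0 (suc (suc M)) y                        ≈⟨ ∑-upTo-suc (suc M) _ ⟩
    series 0 (suc M) y + ι (M C suc M) * y ^ suc M  ≈⟨ +-cong (series-0 M y) (*-congʳ (×-congˡ (k>n⇒nCk≡0 (ℕ.n<1+n M)))) ⟩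
    1# + 0# * y ^ suc M                             ≈⟨ solve 1 (λ t → con 1 :+ con 0 :* t := con 1) refl (y ^ suc M) ⟩
    1#                                              ∎

  -- Pascal's rule, coefficient by coefficient. The identity is exact for truncated series because
  -- the summand multiplied by `y` stops one term earlier.
  series-suc : ∀ k M y → series (suc k) (suc M) y ≈ series k (suc M) y + y * series (suc k) M y
  series-suc k zero y = solve 2 (λ t y → t := t :+ y :* con 0) refl (ι 1 * 1# + 0#) y
  series-suc k (suc M) y = begin
    series (suc k) (suc (suc M)) y
      ≈⟨ ∑-upTo-suc (suc M) _ ⟩
    series (suc k) (suc M) y + ι ((k ℕ.+ suc M) C suc M) * (y * y ^ M)
      ≈⟨ +-cong (series-suc k M y) (*-congʳ pascal) ⟩
    (series k (suc M) y + y * series (suc k) M y) + (ι ((k ℕ.+ M) C M) + ι ((k ℕ.+ suc M ∸ 1) C suc M)) * (y * y ^ M)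
      ≈⟨ solve 6 (λ s y t a b x → (s :+ y :* t) :+ (a :+ b) :* (y :* x) := (s :+ b :* (y :* x)) :+ y :* (t :+ a :* x)) refl _ y _ _ _ _ ⟩
    (series k (suc M) y + ι ((k ℕ.+ suc M ∸ 1) C suc M) * (y * y ^ M)) + y * (series (suc k) M y + ι ((k ℕ.+ M) C M) * y ^ M)
      ≈⟨ +-cong (∑-upTo-suc (suc M) _) (*-congˡ (∑-upTo-suc M _)) ⟨
    series k (suc (suc M)) y + y * series (suc k) (suc M) y ∎
    where
    pascal : ι ((k ℕ.+ suc M) C suc M) ≈ ι ((k ℕ.+ M) C M) + ι ((k ℕ.+ suc M ∸ 1) C suc M)
    pascal rewrite ℕ.+-suc k M = trans (×-congˡ (≡.sym (nCk+nC[k+1]≡[n+1]C[k+1] (k ℕ.+ M) M))) (×-homo-+ 1# ((k ℕ.+ M) C M) ((k ℕ.+ M) C suc M))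

  -- Once `y ^ suc M` vanishes, the shorter truncation in `series-suc` may be lengthened, and the
  -- recursion becomes `S = series k + y S`. Here `z` is `1 - y`, introduced by a sum so that
  -- semiring identities apply without subtraction.
  series-suc-nilpotent : ∀ k M {y z} → y ^ suc M ≈ 0# → z + y ≈ 1# → z * series (suc k) (suc M) y ≈ series k (suc M) y
  series-suc-nilpotent k M {y} {z} y^N z+y = +-cancelʳ (y * S) _ _ (begin
    z * S + y * S                           ≈⟨ distribʳ S z y ⟨
    (z + y) * S                             ≈⟨ trans (*-congʳ z+y) (*-identityˡ S) ⟩
    S                                       ≈⟨ series-suc k M y ⟩
    series k (suc M) y + y * series (suc k) M y  ≈⟨ +-congˡ yS ⟩
    series k (suc M) y + y * S              ∎)
    where
    S = series (suc k) (suc M) y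
    yS : y * series (suc k) M y ≈ y * S
    yS = sym (begin
      y * S                                              ≈⟨ *-congˡ (∑-upTo-suc M _) ⟩
      y * (series (suc k) M y + ι ((k ℕ.+ M) C M) * y ^ M)  ≈⟨ solve 4 (λ y s a x → y :* (s :+ a :* x) := y :* s :+ a :* (y :* x)) refl y _ _ _ ⟩
      y * series (suc k) M y + ι ((k ℕ.+ M) C M) * y ^ suc M  ≈⟨ +-congˡ (*-congˡ y^N) ⟩
      y * series (suc k) M y + ι ((k ℕ.+ M) C M) * 0#    ≈⟨ solve 2 (λ s a → s :+ a :* con 0 := s) refl _ _ ⟩
      y * series (suc k) M y                             ∎)

  series-inverse : ∀ k M {y z} → y ^ suc M ≈ 0# → z + y ≈ 1# → z ^ k * series k (suc M) y ≈ 1#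
  series-inverse zero M {y} y^N z+y = trans (*-identityˡ _) (series-0 M y)
  series-inverse (suc k) M {y} {z} y^N z+y = begin
    (z * z ^ k) * series (suc k) (suc M) y    ≈⟨ solve 3 (λ z t s → (z :* t) :* s := t :* (z :* s)) refl z _ _ ⟩
    z ^ k * (z * series (suc k) (suc M) y)    ≈⟨ *-congˡ (series-suc-nilpotent k M y^N z+y) ⟩
    z ^ k * series k (suc M) y                ≈⟨ series-inverse k M y^N z+y ⟩
    1#                                        ∎

-- Powers and q-integers in a commutative ring.

module Powers {c ℓ} (R : CommutativeRing c ℓ) where
  open CommutativeRing R
  open Exp commutativeSemiring

  1^n≈1 : ∀ n → 1# ^ n ≈ 1#
  1^n≈1 zero    = refl
  1^n≈1 (suc n) = trans (*-identityˡ _) (1^n≈1 n)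

  ^-zero-mono : ∀ {x m n} → x ^ m ≈ 0# → m ≤ n → x ^ n ≈ 0#
  ^-zero-mono {x} {m} {n} x^m m≤n = trans (^-congʳ x (≡.sym (ℕ.m+[n∸m]≡n m≤n)))
    (trans (^-homo-* x m (n ∸ m)) (trans (*-congʳ x^m) (zeroˡ _)))

module QBracket {c ℓ} (R : CommutativeRing c ℓ) (q : CommutativeRing.Carrier R) where
  open CommutativeRing R
  open Exp commutativeSemiring
  open import Relation.Binary.Reasoning.Setoid setoid
  open Solver commutativeSemiring using (solve; _:=_; _:+_; _:*_; con)

  [_] : ℕ → Carrier
  [ zero ]  = 0#
  [ suc m ] = 1# + q * [ m ]

  []-+ : ∀ m n → [ m ℕ.+ n ] ≈ [ m ] + q ^ m * [ n ]
  []-+ zero    n = solve 1 (λ b → b := con 0 :+ con 1 :* b) refl [ n ]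
  []-+ (suc m) n = trans (+-congˡ (*-congˡ ([]-+ m n)))
    (solve 4 (λ q a t b → con 1 :+ q :* (a :+ t :* b) := (con 1 :+ q :* a) :+ (q :* t) :* b) refl q [ m ] (q ^ m) [ n ])

  -- This divisibility carries Bézout identities between integers over to q-integers; the cofactor
  -- is built by adding one block of length `n` at a time.
  []-* : ∀ m n → ∃ λ t → [ m ℕ.* n ] ≈ t * [ n ]
  []-* zero    n = 0# , sym (zeroˡ _)
  []-* (suc m) n with []-* m n
  ... | t , e = 1# + q ^ n * t , (begin
    [ n ℕ.+ m ℕ.* n ]           ≈⟨ []-+ n (m ℕ.* n) ⟩
    [ n ] + q ^ n * [ m ℕ.* n ] ≈⟨ +-congˡ (*-congˡ e) ⟩
    [ n ] + q ^ n * (t * [ n ]) ≈⟨ solve 3 (λ b s t → b :+ s :* (t :* b) := (con 1 :+ s :* t) :* b) refl [ n ] (q ^ n) t ⟩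
    (1# + q ^ n * t) * [ n ]    ∎)

-- Reflection of a single factor, and the resulting identity of nested sums.

-- Here p = r + 1, Q plays the role of q⁻ᵖ and c j that of 1 / [ j ].
module Duality {a ℓ} (R : CommutativeRing a ℓ) (q : CommutativeRing.Carrier R) (r : ℕ) where
  open CommutativeRing R
  open Exp commutativeSemiring
  open Mult semiring using (×1-homo-*)
  open Powers R
  open QBracket R q
  open BinomialSeries R using (ι; series; series-inverse)
  open Sums R
  open Chains R
  open import Relation.Binary.Reasoning.Setoid setoid
  open Solver commutativeSemiring using (solve; _:=_; _:+_; _:*_; con)

  p : ℕ
  p = suc r

  InRange : ℕ → Set
  InRange j = 1 ≤ j ∧ j ≤ r

  module _ (Q : Carrier) (c : ℕ → Carrier)
           (Q-inverse : Q * q ^ p ≈ 1#) (c-inverse : ∀ {j} → InRange j → [ j ] * c j ≈ 1#) where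

    φ ψ : ℕ → ℕ → Carrier
    φ k j = q ^ ((k ∸ 1) ℕ.* j) * c j ^ k
    ψ k j = q ^ j * c j ^ k

    w : Carrier
    w = Q * [ p ]

    InRange-reflect : ∀ {j} → InRange j → InRange (p ∸ j)
    InRange-reflect {suc j} (s≤s z≤n , j<r) = ℕ.m<n⇒0<n∸m j<r , ℕ.m∸n≤m r j

    module _ (M : ℕ) (w-nilpotent : w ^ suc M ≈ 0#) where

      N : ℕ
      N = suc M

      α₁ : ℕ → ℕ → Carrier
      α₁ k l = (- 1# * Q) ^ k * q ^ p * (w ^ l * ι ((k ℕ.+ l ∸ 1) C l))

      ψ-reflect : ∀ {k j} → 1 ≤ k → InRange j → ψ k (p ∸ j) ≈ ∑ (upTo N) (λ l → α₁ k l * φ (k ℕ.+ l) j)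
      ψ-reflect {k@(suc k′)} {j} 1≤k j∈ = begin
        q ^ i * c i ^ k
          ≈⟨ *-identityʳ _ ⟨
        q ^ i * c i ^ k * 1#
          -- The series is inserted together with the power of `z` that it inverts: `z` contains
          -- `[ i ]`, so `z ^ k` cancels `c i ^ k` and leaves powers of `c j`.
          ≈⟨ *-congˡ (series-inverse k M y-nilpotent z+y≈1) ⟨
        q ^ i * c i ^ k * (z ^ k * S)
          ≈⟨ *-congˡ (*-congʳ z^k) ⟩
        q ^ i * c i ^ k * (((n ^ k * c j ^ k) * (q ^ j * (q ^ j) ^ k′ * [ i ] ^ k)) * S)
          -- Of the `k` factors `q ^ j` coming from `z ^ k`, one joins `q ^ i` to form `q ^ p`; the
          -- other `k′` make up the numerator of `φ k j`.
          ≈⟨ solve 7 (λ qi ci nc qj qk bi S → qi :* ci :* ((nc :* (qj :* qk :* bi)) :* S) := (bi :* ci) :* ((qj :* qi) :* (nc :* qk) :* S)) refl (q ^ i) (c i ^ k) (n ^ k * c j ^ k) (q ^ j) ((q ^ j) ^ k′) ([ i ] ^ k) S ⟩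
        ([ i ] ^ k * c i ^ k) * ((q ^ j * q ^ i) * ((n ^ k * c j ^ k) * (q ^ j) ^ k′) * S)
          ≈⟨ *-cong (trans (sym (^-distrib-* [ i ] (c i) k)) (trans (^-congˡ k (c-inverse (InRange-reflect j∈))) (1^n≈1 k))) (*-congʳ (*-congʳ q^j*q^i)) ⟩
        1# * (q ^ p * ((n ^ k * c j ^ k) * (q ^ j) ^ k′) * S)
          ≈⟨ *-identityˡ _ ⟩
        q ^ p * ((n ^ k * c j ^ k) * (q ^ j) ^ k′) * S
          ≈⟨ ∑-*ˡ (upTo N) _ _ ⟩
        ∑ (upTo N) (λ l → q ^ p * ((n ^ k * c j ^ k) * (q ^ j) ^ k′) * (ι ((k ℕ.+ l ∸ 1) C l) * y ^ l))
          ≈⟨ ∑-cong′ (upTo N) term ⟩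
        ∑ (upTo N) (λ l → α₁ k l * φ (k ℕ.+ l) j) ∎
        where
        i = p ∸ j
        n = - 1# * Q
        y = w * (q ^ j * c j)
        -- This is `1 - y`: multiply `[ p ] = [ i ] + qⁱ [ j ]` by `qʲ` and divide by `qᵖ [ j ]`.
        z = (n * c j) * (q ^ j * [ i ])
        S = series k N y
        j≤p : j ≤ p
        j≤p = ℕ.m≤n⇒m≤1+n (proj₂ j∈)
        q^j*q^i : q ^ j * q ^ i ≈ q ^ p
        q^j*q^i = trans (sym (^-homo-* q j i)) (^-congʳ q (ℕ.m+[n∸m]≡n j≤p))
        y-nilpotent : y ^ N ≈ 0#
        y-nilpotent = trans (^-distrib-* w _ N) (trans (*-congʳ w-nilpotent) (zeroˡ _))
        z^k : z ^ k ≈ (n ^ k * c j ^ k) * (q ^ j * (q ^ j) ^ k′ * [ i ] ^ k)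
        z^k = trans (^-distrib-* (n * c j) _ k) (*-cong (^-distrib-* n (c j) k) (^-distrib-* (q ^ j) [ i ] k))
        z+y≈1 : z + y ≈ 1#
        z+y≈1 = begin
          z + w * (q ^ j * c j)
            ≈⟨ +-congˡ (*-congʳ (*-congˡ (trans (reflexive (≡.cong [_] (≡.sym (ℕ.m∸n+n≡m j≤p)))) ([]-+ i j)))) ⟩
          z + Q * ([ i ] + q ^ i * [ j ]) * (q ^ j * c j)
            -- The semiring solver has no negation, so `- 1#` enters as a variable `m`, and `m + 1`
            -- is cancelled in the next step.
            ≈⟨ solve 7 (λ m Q c qj qi bi bj →
                 ((m :* Q) :* c) :* (qj :* bi) :+ Q :* (bi :+ qi :* bj) :* (qj :* c)
                 := (m :+ con 1) :* (Q :* c :* qj :* bi) :+ (Q :* (qj :* qi)) :* (bj :* c))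
                 refl (- 1#) Q (c j) (q ^ j) (q ^ i) [ i ] [ j ] ⟩
          (- 1# + 1#) * (Q * c j * q ^ j * [ i ]) + (Q * (q ^ j * q ^ i)) * ([ j ] * c j)
            ≈⟨ +-cong (*-congʳ (-‿inverseˡ 1#)) (*-cong (trans (*-congˡ q^j*q^i) Q-inverse) (c-inverse j∈)) ⟩
          0# * (Q * c j * q ^ j * [ i ]) + 1# * 1#
            ≈⟨ solve 1 (λ t → con 0 :* t :+ con 1 :* con 1 := con 1) refl _ ⟩
          1# ∎
        q^[k′+l]j : ∀ l → q ^ ((k′ ℕ.+ l) ℕ.* j) ≈ (q ^ j) ^ k′ * (q ^ j) ^ l
        q^[k′+l]j l = trans (^-congʳ q (ℕ.*-comm (k′ ℕ.+ l) j)) (trans (sym (^-assocʳ q j (k′ ℕ.+ l))) (^-homo-* (q ^ j) k′ l))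
        y^l : ∀ l → y ^ l ≈ w ^ l * ((q ^ j) ^ l * c j ^ l)
        y^l l = trans (^-distrib-* w _ l) (*-congˡ (^-distrib-* (q ^ j) (c j) l))
        term : ∀ l → q ^ p * ((n ^ k * c j ^ k) * (q ^ j) ^ k′) * (ι ((k ℕ.+ l ∸ 1) C l) * y ^ l) ≈ α₁ k l * φ (k ℕ.+ l) j
        term l = begin
          q ^ p * ((n ^ k * c j ^ k) * (q ^ j) ^ k′) * (ι ((k ℕ.+ l ∸ 1) C l) * y ^ l)
            ≈⟨ *-congˡ (*-congˡ (y^l l)) ⟩
          q ^ p * ((n ^ k * c j ^ k) * (q ^ j) ^ k′) * (ι ((k ℕ.+ l ∸ 1) C l) * (w ^ l * ((q ^ j) ^ l * c j ^ l)))
            ≈⟨ solve 8 (λ P n c qk ι w ql cl → P :* ((n :* c) :* qk) :* (ι :* (w :* (ql :* cl))) := n :* P :* (w :* ι) :* ((qk :* ql) :* (c :* cl))) refl (q ^ p) (n ^ k) (c j ^ k) ((q ^ j) ^ k′) _ (w ^ l) ((q ^ j) ^ l) (c j ^ l) ⟩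
          α₁ k l * (((q ^ j) ^ k′ * (q ^ j) ^ l) * (c j ^ k * c j ^ l))
            ≈⟨ *-congˡ (*-cong (q^[k′+l]j l) (^-homo-* (c j) k l)) ⟨
          α₁ k l * φ (k ℕ.+ l) j ∎

      α : List ℕ → List ℕ → Carrier
      α ks ls = (- 1# * Q) ^ wt ks * (q ^ p) ^ dep ks * (w ^ wt ls * ι (bbin ks ls))

      α-[] : α [] [] ≈ 1#
      α-[] = solve 0 (con 1 :* con 1 :* (con 1 :* (con 1 :+ con 0)) := con 1) refl

      α-∷ : ∀ k ks l ls → α (k ∷ ks) (l ∷ ls) ≈ α₁ k l * α ks ls
      α-∷ k ks l ls = trans
        (*-cong (*-congʳ (^-homo-* (- 1# * Q) k (wt ks))) (*-cong (^-homo-* w l (wt ls)) (×1-homo-* ((k ℕ.+ l ∸ 1) C l) (bbin ks ls))))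
        (solve 8 (λ n n′ P P′ w w′ b b′ → (n :* n′) :* (P :* P′) :* ((w :* w′) :* (b :* b′)) := (n :* P :* (w :* b)) :* (n′ :* P′ :* (w′ :* b′)))
          refl _ _ _ _ _ _ _ _)

      chain-duality : ∀ s ks → All (1 ≤_) ks →
        chain s (applyDownFrom suc r) (map ψ ks) ≈
        (- 1# * Q) ^ wt ks * ((q ^ p) ^ dep ks *
          ∑ (lowWt (dep ks) N) (λ ls → w ^ wt ls * (ι (bbin ks ls) *
            chain s (applyDownFrom suc r) (map φ (reverse (zipWith ℕ._+_ ks ls))))))
      chain-duality s ks 1≤ks = begin
        chain s (applyDownFrom suc r) (map ψ ks)
          -- The decreasing range `r , … , 1` is `p - 1 , … , p - r`, the reflection of the
          -- increasing one.
          ≡⟨ ≡.cong (λ L → chain s L (map ψ ks)) (≡.trans (List.map-applyUpTo suc (p ∸_) r) (reflect-range r)) ⟨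
        chain s (map (p ∸_) (applyUpTo suc r)) (map ψ ks)
          ≈⟨ chain-map s (p ∸_) (applyUpTo suc r) ks ψ ⟩
        chain s (applyUpTo suc r) (map (λ k → ψ k ∘ (p ∸_)) ks)
          ≈⟨ chain-cong s _ _ ψ-reflect (applyUpTo⁺₁ suc r (λ i<r → s≤s z≤n , i<r)) 1≤ks ⟩
        chain s (applyUpTo suc r) (map (λ k j → ∑ (upTo N) (λ l → α₁ k l * φ (k ℕ.+ l) j)) ks)
          ≈⟨ chain-multilinear s N φ α₁ α α-[] α-∷ ks (applyUpTo suc r) ⟩
        ∑ (box (dep ks) N) (λ ls → α ks ls * chain s (applyUpTo suc r) (map φ (zipWith ℕ._+_ ks ls)))
          ≈⟨ ∑-cong′ (box (dep ks) N) (λ ls → *-congˡ (reversed (zipWith ℕ._+_ ks ls))) ⟨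
        ∑ (box (dep ks) N) (λ ls → α ks ls * T ls)
          -- Multilinear expansion bounds each entry of `ls` separately; the terms of total weight
          -- at least `N` contain `w ^ N` and drop out.
          ≈⟨ ∑-filter (λ ls → sum ls <? N) (box (dep ks) N) vanish ⟨
        ∑ (lowWt (dep ks) N) (λ ls → α ks ls * T ls)
          ≈⟨ ∑-cong′ (lowWt (dep ks) N) (λ ls → solve 5 (λ a b c d t → (a :* b :* (c :* d)) :* t := (a :* b) :* (c :* (d :* t))) refl _ _ _ _ _) ⟩
        ∑ (lowWt (dep ks) N) (λ ls → ((- 1# * Q) ^ wt ks * (q ^ p) ^ dep ks) * (w ^ wt ls * (ι (bbin ks ls) * T ls)))
          ≈⟨ ∑-*ˡ (lowWt (dep ks) N) _ _ ⟨
        ((- 1# * Q) ^ wt ks * (q ^ p) ^ dep ks) * ∑ (lowWt (dep ks) N) (λ ls → w ^ wt ls * (ι (bbin ks ls) * T ls))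
          ≈⟨ *-assoc _ _ _ ⟩
        (- 1# * Q) ^ wt ks * ((q ^ p) ^ dep ks * ∑ (lowWt (dep ks) N) (λ ls → w ^ wt ls * (ι (bbin ks ls) * T ls))) ∎
        where
        T : List ℕ → Carrier
        T ls = chain s (applyDownFrom suc r) (map φ (reverse (zipWith ℕ._+_ ks ls)))
        reflect-range : ∀ r → applyUpTo (r ∸_) r ≡ applyDownFrom suc r
        reflect-range zero    = ≡.refl
        reflect-range (suc r) = ≡.cong (suc r ∷_) (reflect-range r)
        reversed : ∀ ms → chain s (applyDownFrom suc r) (map φ (reverse ms)) ≈ chain s (applyUpTo suc r) (map φ ms)
        reversed ms = begin
          chain s (applyDownFrom suc r) (map φ (reverse ms))
            ≡⟨ ≡.cong₂ (chain s) (≡.sym (List.reverse-applyUpTo suc r)) (List.reverse-map φ ms) ⟩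
          chain s (reverse (applyUpTo suc r)) (reverse (map φ ms))
            ≈⟨ chain-reverse s (applyUpTo suc r) (map φ ms) ⟩
          chain s (applyUpTo suc r) (map φ ms) ∎
        vanish : ∀ ls → ¬ (sum ls < N) → α ks ls * T ls ≈ 0#
        vanish ls ≮N = trans (*-congʳ (*-congˡ (*-congʳ (^-zero-mono w-nilpotent (ℕ.≮⇒≥ ≮N)))))
          (solve 3 (λ a b t → (a :* (con 0 :* b)) :* t := con 0) refl _ _ _)

-- Integer polynomials in q as a commutative ring.

module ℤ[q] where
  open ≡ using (cong; cong₂; sym; trans)
  open +-*-Solver using (solve; _:=_; _:+_; _:*_; con)

  infix  4 _≈_
  infixl 6 _+_
  infixl 7 _*_
  infix  8 -_

  coefficient : List ℤ → ℕ → ℤ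
  coefficient []      i       = 0ℤ
  coefficient (a ∷ f) zero    = a
  coefficient (a ∷ f) (suc i) = coefficient f i

  -- Coefficientwise, because coefficient lists may end in zeros. Wrapping the family in a record
  -- keeps `f` and `g` recoverable from the type of a proof.
  record _≈_ (f g : List ℤ) : Set where
    constructor coefficientwise
    field at : ∀ i → coefficient f i ≡ coefficient g i
  open _≈_ public

  _+_ : List ℤ → List ℤ → List ℤ
  []      + g       = g
  (a ∷ f) + []      = a ∷ f
  (a ∷ f) + (b ∷ g) = (a ℤ.+ b) ∷ (f + g)

  scale : ℤ → List ℤ → List ℤ
  scale c = map (c ℤ.*_)

  -_ : List ℤ → List ℤ
  -_ = map (λ a → ℤ.- a)

  _*_ : List ℤ → List ℤ → List ℤ
  []      * g = []
  (a ∷ f) * g = scale a g + (0ℤ ∷ f * g)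

  ≈-refl : ∀ {f} → f ≈ f
  ≈-refl .at i = ≡.refl

  ≈-sym : ∀ {f g} → f ≈ g → g ≈ f
  ≈-sym e .at i = sym (at e i)

  ≈-trans : ∀ {f g h} → f ≈ g → g ≈ h → f ≈ h
  ≈-trans e e′ .at i = trans (at e i) (at e′ i)

  coefficient-+ : ∀ f g i → coefficient (f + g) i ≡ coefficient f i ℤ.+ coefficient g i
  coefficient-+ []      g       i       = sym (ℤ.+-identityˡ _)
  coefficient-+ (a ∷ f) []      i       = sym (ℤ.+-identityʳ _)
  coefficient-+ (a ∷ f) (b ∷ g) zero    = ≡.refl
  coefficient-+ (a ∷ f) (b ∷ g) (suc i) = coefficient-+ f g i

  coefficient-scale : ∀ c f i → coefficient (scale c f) i ≡ c ℤ.* coefficient f i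
  coefficient-scale c []      i       = sym (ℤ.*-zeroʳ c)
  coefficient-scale c (a ∷ f) zero    = ≡.refl
  coefficient-scale c (a ∷ f) (suc i) = coefficient-scale c f i

  coefficient-neg : ∀ f i → coefficient (- f) i ≡ ℤ.- coefficient f i
  coefficient-neg []      i       = ≡.refl
  coefficient-neg (a ∷ f) zero    = ≡.refl
  coefficient-neg (a ∷ f) (suc i) = coefficient-neg f i

  coefficient-* : ∀ a f g i → coefficient ((a ∷ f) * g) i ≡ a ℤ.* coefficient g i ℤ.+ coefficient (0ℤ ∷ f * g) i
  coefficient-* a f g i = trans (coefficient-+ (scale a g) _ i) (cong (ℤ._+ _) (coefficient-scale a g i))

  +-cong : ∀ {f f′ g g′} → f ≈ f′ → g ≈ g′ → f + g ≈ f′ + g′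
  +-cong {f} {f′} {g} {g′} e e′ .at i =
    trans (coefficient-+ f g i) (trans (cong₂ ℤ._+_ (at e i) (at e′ i)) (sym (coefficient-+ f′ g′ i)))

  neg-cong : ∀ {f g} → f ≈ g → - f ≈ - g
  neg-cong {f} {g} e .at i = trans (coefficient-neg f i) (trans (cong (λ a → ℤ.- a) (at e i)) (sym (coefficient-neg g i)))

  +-assoc : ∀ f g h → (f + g) + h ≈ f + (g + h)
  +-assoc f g h .at i
    rewrite coefficient-+ (f + g) h i | coefficient-+ f g i | coefficient-+ f (g + h) i | coefficient-+ g h i
    = ℤ.+-assoc (coefficient f i) _ _

  +-comm : ∀ f g → f + g ≈ g + f
  +-comm f g .at i rewrite coefficient-+ f g i | coefficient-+ g f i = ℤ.+-comm (coefficient f i) _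

  +-identityʳ : ∀ f → f + [] ≈ f
  +-identityʳ f .at i = trans (coefficient-+ f [] i) (ℤ.+-identityʳ _)

  -‿inverseʳ : ∀ f → f + - f ≈ []
  -‿inverseʳ f .at i rewrite coefficient-+ f (- f) i | coefficient-neg f i = ℤ.+-inverseʳ (coefficient f i)

  -‿inverseˡ : ∀ f → - f + f ≈ []
  -‿inverseˡ f = ≈-trans (+-comm (- f) f) (-‿inverseʳ f)

  ∷-cong : ∀ {a f g} → f ≈ g → a ∷ f ≈ a ∷ g
  ∷-cong e .at zero    = ≡.refl
  ∷-cong e .at (suc i) = at e i

  scale-cong : ∀ a {f g} → f ≈ g → scale a f ≈ scale a g
  scale-cong a {f} {g} e .at i = trans (coefficient-scale a f i) (trans (cong (a ℤ.*_) (at e i)) (sym (coefficient-scale a g i)))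

  0∷[]≈[] : 0ℤ ∷ [] ≈ []
  0∷[]≈[] .at zero    = ≡.refl
  0∷[]≈[] .at (suc i) = ≡.refl

  *-congˡ : ∀ f {g g′} → g ≈ g′ → f * g ≈ f * g′
  *-congˡ []      e = ≈-refl
  *-congˡ (a ∷ f) e = +-cong (scale-cong a e) (∷-cong (*-congˡ f e))

  *-zeroʳ : ∀ f → f * [] ≈ []
  *-zeroʳ []      = ≈-refl
  *-zeroʳ (a ∷ f) = ≈-trans (∷-cong (*-zeroʳ f)) 0∷[]≈[]

  -- Multiplication recurses on its left argument only; this is the matching recursion on the right
  -- one, from which commutativity follows.
  *-∷ʳ : ∀ f b g → f * (b ∷ g) ≈ scale b f + (0ℤ ∷ f * g)
  *-∷ʳ [] b g = ≈-sym 0∷[]≈[]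
  *-∷ʳ (a ∷ f) b g .at zero = cong (ℤ._+ 0ℤ) (ℤ.*-comm a b)
  *-∷ʳ (a ∷ f) b g .at (suc i)
    rewrite coefficient-+ (scale a g) (f * (b ∷ g)) i | coefficient-scale a g i
          | at (*-∷ʳ f b g) i
          | coefficient-+ (scale b f) (0ℤ ∷ f * g) i | coefficient-scale b f i
          | coefficient-+ (scale b f) ((a ∷ f) * g) i | coefficient-scale b f i
          | coefficient-* a f g i
    = solve 3 (λ x y z → x :+ (y :+ z) := y :+ (x :+ z)) ≡.refl (a ℤ.* coefficient g i) (b ℤ.* coefficient f i) _

  *-comm : ∀ f g → f * g ≈ g * f
  *-comm []      g = ≈-sym (*-zeroʳ g)
  *-comm (a ∷ f) g = ≈-trans (+-cong ≈-refl (∷-cong (*-comm f g))) (≈-sym (*-∷ʳ g a f))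

  *-cong : ∀ {f f′ g g′} → f ≈ f′ → g ≈ g′ → f * g ≈ f′ * g′
  *-cong {f} {f′} {g} {g′} e e′ =
    ≈-trans (*-congˡ f e′) (≈-trans (*-comm f g′) (≈-trans (*-congˡ g′ e) (*-comm g′ f′)))

  *-distribˡ-+ : ∀ f g h → f * (g + h) ≈ f * g + f * h
  *-distribˡ-+ [] g h = ≈-refl
  *-distribˡ-+ (a ∷ f) g h .at i
    rewrite coefficient-* a f (g + h) i | coefficient-+ g h i
          | coefficient-+ ((a ∷ f) * g) ((a ∷ f) * h) i | coefficient-* a f g i | coefficient-* a f h i
    = trans (cong (λ t → a ℤ.* (coefficient g i ℤ.+ coefficient h i) ℤ.+ t) (shifted i))
      (solve 5 (λ a x y u v → a :* (x :+ y) :+ (u :+ v) := (a :* x :+ u) :+ (a :* y :+ v)) ≡.refl a (coefficient g i) (coefficient h i) _ _)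
    where
    shifted : ∀ i → coefficient (0ℤ ∷ f * (g + h)) i ≡ coefficient (0ℤ ∷ f * g) i ℤ.+ coefficient (0ℤ ∷ f * h) i
    shifted zero    = ≡.refl
    shifted (suc i) = trans (at (*-distribˡ-+ f g h) i) (coefficient-+ (f * g) (f * h) i)

  *-distribʳ-+ : ∀ h f g → (f + g) * h ≈ f * h + g * h
  *-distribʳ-+ h f g = ≈-trans (*-comm (f + g) h) (≈-trans (*-distribˡ-+ h f g) (+-cong (*-comm h f) (*-comm h g)))

  scale-* : ∀ a f g → scale a f * g ≈ scale a (f * g)
  scale-* a [] g = ≈-refl
  scale-* a (b ∷ f) g .at i
    rewrite coefficient-* (a ℤ.* b) (scale a f) g i | coefficient-scale a ((b ∷ f) * g) i | coefficient-* b f g i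
    = trans (cong (λ t → a ℤ.* b ℤ.* coefficient g i ℤ.+ t) (shifted i))
      (solve 4 (λ a b x u → a :* b :* x :+ a :* u := a :* (b :* x :+ u)) ≡.refl a b (coefficient g i) _)
    where
    shifted : ∀ i → coefficient (0ℤ ∷ scale a f * g) i ≡ a ℤ.* coefficient (0ℤ ∷ f * g) i
    shifted zero    = sym (ℤ.*-zeroʳ a)
    shifted (suc i) = trans (at (scale-* a f g) i) (coefficient-scale a (f * g) i)

  shift-* : ∀ f g → (0ℤ ∷ f) * g ≈ 0ℤ ∷ f * g
  shift-* f g .at i = trans (coefficient-* 0ℤ f g i) (ℤ.+-identityˡ _)

  *-assoc : ∀ f g h → (f * g) * h ≈ f * (g * h)
  *-assoc []      g h = ≈-refl
  *-assoc (a ∷ f) g h =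
    ≈-trans (*-distribʳ-+ h (scale a g) (0ℤ ∷ f * g))
    (+-cong (scale-* a g h) (≈-trans (shift-* (f * g) h) (∷-cong (*-assoc f g h))))

  *-identityˡ : ∀ f → (1ℤ ∷ []) * f ≈ f
  *-identityˡ f .at i = trans (coefficient-* 1ℤ [] f i)
    (trans (cong₂ ℤ._+_ (ℤ.*-identityˡ (coefficient f i)) (at 0∷[]≈[] i)) (ℤ.+-identityʳ _))

  commutativeRing : CommutativeRing 0ℓ 0ℓ
  commutativeRing = record
    { Carrier = List ℤ ; _≈_ = _≈_ ; _+_ = _+_ ; _*_ = _*_ ; -_ = -_ ; 0# = [] ; 1# = 1ℤ ∷ []
    ; isCommutativeRing = record
      { isRing = record
        { +-isAbelianGroup = record
          { isGroup = record
            { isMonoid = record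
              { isSemigroup = record
                { isMagma = record
                  { isEquivalence = record { refl = ≈-refl ; sym = ≈-sym ; trans = ≈-trans }
                  ; ∙-cong = +-cong }
                ; assoc = +-assoc }
              ; identity = (λ f → ≈-refl) , +-identityʳ }
            ; inverse = -‿inverseˡ , -‿inverseʳ
            ; ⁻¹-cong = neg-cong }
          ; comm = +-comm }
        ; *-cong = *-cong
        ; *-assoc = *-assoc
        ; *-identity = *-identityˡ , (λ f → ≈-trans (*-comm f _) (*-identityˡ f))
        ; distrib = *-distribˡ-+ , *-distribʳ-+ }
      ; *-comm = *-comm } }

-- Quotient of a commutative ring by a principal ideal.

module PrincipalQuotient {a ℓ} (R : CommutativeRing a ℓ) (m : CommutativeRing.Carrier R) where
  open CommutativeRing R
  open RingProperties ring using (-‿distribʳ-*; -‿+-comm)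
  open import Relation.Binary.Reasoning.Setoid setoid
  open Solver commutativeSemiring using (solve; _:=_; _:+_; _:*_; con)

  infix 4 _~_
  -- The cofactor is kept as data: with `m` equal to `[ p ]ⁿ` it becomes the quotient polynomial
  -- that `DivBy` asks for.
  record _~_ (x y : Carrier) : Set (a ⊔ ℓ) where
    constructor by
    field
      factor   : Carrier
      equality : x ≈ y + m * factor

  ≈⇒~ : ∀ {x y} → x ≈ y → x ~ y
  ≈⇒~ {x} {y} e = by 0# (trans e (solve 2 (λ y m → y := y :+ m :* con 0) refl y m))

  ~-sym : ∀ {x y} → x ~ y → y ~ x
  ~-sym {x} {y} (by h e) = by (- h) (begin
    y                          ≈⟨ +-identityʳ y ⟨
    y + 0#                     ≈⟨ +-congˡ (trans (*-congˡ (-‿inverseʳ h)) (zeroʳ m)) ⟨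
    y + m * (h + - h)          ≈⟨ solve 4 (λ y m h n → y :+ m :* (h :+ n) := (y :+ m :* h) :+ m :* n) refl y m h (- h) ⟩
    (y + m * h) + m * - h      ≈⟨ +-congʳ e ⟨
    x + m * - h                ∎)

  ~-trans : ∀ {x y z} → x ~ y → y ~ z → x ~ z
  ~-trans {x} {y} {z} (by h e) (by h′ e′) = by (h′ + h) (trans e (trans (+-congʳ e′)
    (solve 4 (λ z m h h′ → (z :+ m :* h′) :+ m :* h := z :+ m :* (h′ :+ h)) refl z m h h′)))

  +-cong-~ : ∀ {x x′ y y′} → x ~ x′ → y ~ y′ → x + y ~ x′ + y′
  +-cong-~ {x} {x′} {y} {y′} (by h e) (by h′ e′) = by (h + h′) (trans (+-cong e e′)
    (solve 5 (λ x y m h h′ → (x :+ m :* h) :+ (y :+ m :* h′) := (x :+ y) :+ m :* (h :+ h′)) refl x′ y′ m h h′))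

  *-cong-~ : ∀ {x x′ y y′} → x ~ x′ → y ~ y′ → x * y ~ x′ * y′
  *-cong-~ {x} {x′} {y} {y′} (by h e) (by h′ e′) = by (x′ * h′ + h * (y′ + m * h′)) (trans (*-cong e e′)
    (solve 5 (λ x y m h h′ → (x :+ m :* h) :* (y :+ m :* h′) := x :* y :+ m :* (x :* h′ :+ h :* (y :+ m :* h′))) refl x′ y′ m h h′))

  neg-cong-~ : ∀ {x y} → x ~ y → - x ~ - y
  neg-cong-~ {x} {y} (by h e) = by (- h) (trans (-‿cong e) (trans (sym (-‿+-comm y (m * h))) (+-congˡ (-‿distribʳ-* m h))))

  m~0 : m ~ 0#
  m~0 = by 1# (solve 1 (λ m → m := con 0 :+ m :* con 1) refl m)

  commutativeRing/ : CommutativeRing a (a ⊔ ℓ)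
  commutativeRing/ = record
    { Carrier = Carrier ; _≈_ = _~_ ; _+_ = _+_ ; _*_ = _*_ ; -_ = -_ ; 0# = 0# ; 1# = 1#
    ; isCommutativeRing = record
      { isRing = record
        { +-isAbelianGroup = record
          { isGroup = record
            { isMonoid = record
              { isSemigroup = record
                { isMagma = record
                  { isEquivalence = record { refl = ≈⇒~ refl ; sym = ~-sym ; trans = ~-trans }
                  ; ∙-cong = +-cong-~ }
                ; assoc = λ x y z → ≈⇒~ (+-assoc x y z) }
              ; identity = (λ x → ≈⇒~ (+-identityˡ x)) , (λ x → ≈⇒~ (+-identityʳ x)) }
            ; inverse = (λ x → ≈⇒~ (-‿inverseˡ x)) , (λ x → ≈⇒~ (-‿inverseʳ x))
            ; ⁻¹-cong = neg-cong-~ }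
          ; comm = λ x y → ≈⇒~ (+-comm x y) }
        ; *-cong = *-cong-~
        ; *-assoc = λ x y z → ≈⇒~ (*-assoc x y z)
        ; *-identity = (λ x → ≈⇒~ (*-identityˡ x)) , (λ x → ≈⇒~ (*-identityʳ x))
        ; distrib = (λ x y z → ≈⇒~ (distribˡ x y z)) , (λ x y z → ≈⇒~ (distribʳ x y z)) }
      ; *-comm = λ x y → ≈⇒~ (*-comm x y) } }

-- Integer polynomials among the rational ones.

module Embedding where
  open ≡ using (cong; cong₂; sym; trans)
  open +-*-Solver using (solve; _:=_; _:+_; _:*_; con)

  -- Built directly in lowest terms, so that the denominator is 1 by computation; integrality at
  -- every prime is then immediate.
  fromℤ : ℤ → ℚ
  fromℤ z = mkℚ z 0 (Coprimality.sym (Coprimality.1-coprimeTo ℤ.∣ z ∣))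

  fromℤ-+ : ∀ a b → fromℤ (a ℤ.+ b) ≡ fromℤ a ℚ.+ fromℤ b
  fromℤ-+ a b = ℚ.toℚᵘ-injective (ℚᵘ.≃-trans
    (*≡* (solve 2 (λ a b → (a :+ b) :* con 1ℤ := (a :* con 1ℤ :+ b :* con 1ℤ) :* con 1ℤ) ≡.refl a b))
    (ℚᵘ.≃-sym (ℚ.toℚᵘ-homo-+ (fromℤ a) (fromℤ b))))

  fromℤ-* : ∀ a b → fromℤ (a ℤ.* b) ≡ fromℤ a ℚ.* fromℤ b
  fromℤ-* a b = ℚ.toℚᵘ-injective (ℚᵘ.≃-trans (*≡* ≡.refl) (ℚᵘ.≃-sym (ℚ.toℚᵘ-homo-* (fromℤ a) (fromℤ b))))

  fromℤ-neg : ∀ a → fromℤ (ℤ.- a) ≡ ℚ.- fromℤ a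
  fromℤ-neg a = ℚ.toℚᵘ-injective (ℚᵘ.≃-trans (*≡* ≡.refl) (ℚᵘ.≃-sym (ℚ.toℚᵘ-homo‿- (fromℤ a))))

  fromℤ-fromℕ : ∀ n → fromℕQ n ≡ fromℤ (+ n)
  fromℤ-fromℕ n = ℚ.fromℚᵘ-toℚᵘ (fromℤ (+ n))

  embed : List ℤ → Poly
  embed = map fromℤ

  embed-+ : ∀ f g → addP (embed f) (embed g) ≡ embed (f ℤ[q].+ g)
  embed-+ []      g       = ≡.refl
  embed-+ (a ∷ f) []      = ≡.refl
  embed-+ (a ∷ f) (b ∷ g) = cong₂ _∷_ (sym (fromℤ-+ a b)) (embed-+ f g)

  embed-neg : ∀ f → negP (embed f) ≡ embed (ℤ[q].- f)
  embed-neg []      = ≡.refl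
  embed-neg (a ∷ f) = cong₂ _∷_ (sym (fromℤ-neg a)) (embed-neg f)

  embed-scale : ∀ a f → scaleP (fromℤ a) (embed f) ≡ embed (ℤ[q].scale a f)
  embed-scale a []      = ≡.refl
  embed-scale a (b ∷ f) = cong₂ _∷_ (sym (fromℤ-* a b)) (embed-scale a f)

  embed-* : ∀ f g → mulP (embed f) (embed g) ≡ embed (f ℤ[q].* g)
  embed-* []      g = ≡.refl
  embed-* (a ∷ f) g = trans (cong₂ addP (embed-scale a g) (cong (ℚ.0ℚ ∷_) (embed-* f g)))
                            (embed-+ (ℤ[q].scale a g) (0ℤ ∷ f ℤ[q].* g))

  coeff-embed : ∀ f i → coeff (embed f) i ≡ fromℤ (ℤ[q].coefficient f i)
  coeff-embed []      i       = ≡.refl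
  coeff-embed (a ∷ f) zero    = ≡.refl
  coeff-embed (a ∷ f) (suc i) = coeff-embed f i

  embed-cong : ∀ {f g} → f ℤ[q].≈ g → embed f ≈P embed g
  embed-cong {f} {g} e i = trans (coeff-embed f i) (trans (cong fromℤ (ℤ[q].at e i)) (sym (coeff-embed g i)))

-- Keeping ℤ[q] abstract stops its operations on coefficient lists from unfolding.
record IntegralSubring : Set₁ where
  field
    integers : CommutativeRing 0ℓ 0ℓ
  open CommutativeRing integers
  open Mult semiring using (_×_)
  field
    q              : Carrier
    embed          : Carrier → Poly
    embed-cong     : ∀ {x y} → x ≈ y → embed x ≈P embed y
    embed-+        : ∀ x y → addP (embed x) (embed y) ≡ embed (x + y)
    embed-*        : ∀ x y → mulP (embed x) (embed y) ≡ embed (x * y)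
    embed-neg      : ∀ x → negP (embed x) ≡ embed (- x)
    embed-0        : [] ≡ embed 0#
    embed-1        : oneP ≡ embed 1#
    embed-q        : X ≡ embed q
    constant       : ∀ m → ∃ λ x → constP (fromℕQ m) ≡ embed x ∧ x ≈ m × 1#
    embed-integral : ∀ {p} → Prime p → ∀ x → IntP p (embed x)

ℤ[q]⊂ℚ[q] : IntegralSubring
ℤ[q]⊂ℚ[q] = record
  { integers = ℤ[q].commutativeRing
  ; q = 0ℤ ∷ 1ℤ ∷ []
  ; embed = embed
  ; embed-cong = embed-cong
  ; embed-+ = embed-+
  ; embed-* = embed-*
  ; embed-neg = embed-neg
  ; embed-0 = ≡.refl
  ; embed-1 = ≡.refl
  ; embed-q = ≡.refl
  ; constant = λ m → + m ∷ [] , ≡.cong (_∷ []) (fromℤ-fromℕ m) , constant≈ m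
  ; embed-integral = embed-integral }
  where
  open Embedding
  open Mult (CommutativeRing.semiring ℤ[q].commutativeRing) using (_×_)
  constant≈ : ∀ m → (+ m ∷ []) ℤ[q].≈ m × (1ℤ ∷ [])
  constant≈ zero    = ℤ[q].0∷[]≈[]
  constant≈ (suc m) = ℤ[q].+-cong {1ℤ ∷ []} ℤ[q].≈-refl (constant≈ m)
  embed-integral : ∀ {p} → Prime p → ∀ f → IntP p (embed f)
  embed-integral p-prime f i rewrite coeff-embed f i = λ p∣1 → ¬prime[1] (≡.subst Prime (∣1⇒≡1 p∣1) p-prime)

-- Invertibility of q and of the q-integers modulo a power of `[ p ]`.

module Units {c ℓ} (R : CommutativeRing c ℓ) where
  open CommutativeRing R
  open Exp commutativeSemiring
  open Powers R
  open BinomialSeries R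
  open Solver commutativeSemiring using (solve; _:=_; _:+_; _:*_; con)

  Unit : Carrier → Set _
  Unit x = ∃ λ v → x * v ≈ 1#

  -- Since `u * x` is `1 - t`, the inverse is `u` times the geometric series in `t`, which is the
  -- binomial series of exponent 1.
  1-nilpotent-unit : ∀ n {x u t} → t ^ n ≈ 0# → u * x + t ≈ 1# → Unit x
  1-nilpotent-unit n {x} {u} {t} t^n e = u * series 1 (suc n) t ,
    trans (solve 3 (λ x u s → x :* (u :* s) := (u :* x) :* con 1 :* s) refl x u _)
          (series-inverse 1 n (^-zero-mono t^n (ℕ.n≤1+n n)) e)

  ^-unit : ∀ {x} n → Unit x → Unit (x ^ n)
  ^-unit {x} n (v , e) = v ^ n , trans (sym (^-distrib-* x v n)) (trans (^-congˡ n e) (1^n≈1 n))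

module BracketUnits {c ℓ} (R : CommutativeRing c ℓ) (q : CommutativeRing.Carrier R) (r n : ℕ) where
  open CommutativeRing R
  open Exp commutativeSemiring
  open QBracket R q
  open Units R
  open Duality R q r using (p; InRange)
  open import Relation.Binary.Reasoning.Setoid setoid
  open Solver commutativeSemiring using (solve; _:=_; _:+_; _:*_; con)

  module _ ([p]^n≈0 : [ p ] ^ n ≈ 0#) where

    multiple-nilpotent : ∀ s → (s * [ p ]) ^ n ≈ 0#
    multiple-nilpotent s = trans (^-distrib-* s [ p ] n) (trans (*-congˡ [p]^n≈0) (zeroʳ _))

    cancel-negative : ∀ a b → (1# + a * b) + - a * b ≈ 1#
    cancel-negative a b = begin
      (1# + a * b) + - a * b  ≈⟨ solve 3 (λ a b m → (con 1 :+ a :* b) :+ m :* b := con 1 :+ (a :+ m) :* b) refl a b (- a) ⟩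
      1# + (a + - a) * b      ≈⟨ +-congˡ (trans (*-congʳ (-‿inverseʳ a)) (zeroˡ b)) ⟩
      1# + 0#                 ≈⟨ +-identityʳ 1# ⟩
      1#                      ∎

    -- By definition `[ p ]` is `1 + q [ r ]`, so `- [ r ] * q` is 1 minus a nilpotent.
    q-unit : Unit q
    q-unit = 1-nilpotent-unit n {u = - [ r ]} [p]^n≈0 (begin
      - [ r ] * q + (1# + q * [ r ])  ≈⟨ solve 3 (λ m q b → m :* q :+ (con 1 :+ q :* b) := (con 1 :+ b :* q) :+ m :* q) refl (- [ r ]) q [ r ] ⟩
      (1# + [ r ] * q) + - [ r ] * q  ≈⟨ cancel-negative [ r ] q ⟩
      1#                              ∎)

    -- Bézout gives `1 + y j = x p` or `1 + x p = y j`. Taking q-integers turns the added 1 into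
    -- `1 + q [ ... ]`, and divisibility makes the two products multiples of `[ p ]` and `[ j ]`. In
    -- either case some multiple of `[ j ]` differs from 1 by a multiple of `[ p ]`.
    []-unit : Prime p → ∀ {j} → InRange j → Unit [ j ]
    []-unit p-prime {suc i} (s≤s z≤n , j≤r) with coprime-Bézout (prime⇒coprime p-prime (s≤s j≤r))
    ... | Bézout.+- x y e with []-* x p | []-* y (suc i)
    ...   | t , [xp] | t′ , [yj] = 1-nilpotent-unit n {u = - (q * t′)} (multiple-nilpotent t) (begin
      - (q * t′) * [ j ] + t * [ p ]                 ≈⟨ +-congˡ (trans (sym [xp]) (reflexive (≡.cong [_] (≡.sym e)))) ⟩
      - (q * t′) * [ j ] + (1# + q * [ y ℕ.* j ])    ≈⟨ +-congˡ (+-congˡ (*-congˡ [yj])) ⟩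
      - (q * t′) * [ j ] + (1# + q * (t′ * [ j ]))   ≈⟨ solve 4 (λ m q t b → m :* b :+ (con 1 :+ q :* (t :* b)) := (con 1 :+ (q :* t) :* b) :+ m :* b) refl _ q t′ [ j ] ⟩
      (1# + (q * t′) * [ j ]) + - (q * t′) * [ j ]   ≈⟨ cancel-negative (q * t′) [ j ] ⟩
      1#                                             ∎)
      where j = suc i
    []-unit p-prime {suc i} (s≤s z≤n , j≤r) | Bézout.-+ x y e with []-* x p | []-* y (suc i)
    ...   | t , [xp] | t′ , [yj] = 1-nilpotent-unit n {u = t′} (multiple-nilpotent (- (q * t))) (begin
      t′ * [ j ] + - (q * t) * [ p ]                 ≈⟨ +-congʳ (trans (sym [yj]) (reflexive (≡.cong [_] (≡.sym e)))) ⟩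
      (1# + q * [ x ℕ.* p ]) + - (q * t) * [ p ]     ≈⟨ +-congʳ (+-congˡ (trans (*-congˡ [xp]) (sym (*-assoc q t _)))) ⟩
      (1# + (q * t) * [ p ]) + - (q * t) * [ p ]     ≈⟨ cancel-negative (q * t) [ p ] ⟩
      1#                                             ∎)
      where j = suc i

    q^p-unit : Unit (q ^ p)
    q^p-unit = ^-unit p q-unit

    []-inverse : Prime p → ∀ j → ∃ λ v → InRange j → [ j ] * v ≈ 1#
    []-inverse p-prime j with 1 ≤? j ×-dec j ≤? r
    ... | yes j∈ = proj₁ ([]-unit p-prime j∈) , λ _ → proj₂ ([]-unit p-prime j∈)
    -- A default outside the range, which makes the choice of inverses a total function of `j`.
    ... | no j∉  = 0# , λ j∈ → contradiction j∈ j∉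

-- Values of polynomials and fractions in the quotient ring.

module Representation (A : IntegralSubring) where
  open IntegralSubring A
  open CommutativeRing integers
  open Exp commutativeSemiring
  open Sums integers
  open QBracket integers q
  open BinomialSeries integers using (ι)
  open import Relation.Binary.Reasoning.Setoid setoid

  infix 4 _▷_
  -- The list `f` is literally an embedded element, but that element equals `x` only in the ring:
  -- for the constant 0 the lists are `0 ∷ []` and `[]`.
  record _▷_ (f : Poly) (x : Carrier) : Set where
    constructor represents
    field
      {element} : Carrier
      embeds    : f ≡ embed element
      element≈  : element ≈ x

  ▷-≈ : ∀ {f x y} → f ▷ x → x ≈ y → f ▷ y
  ▷-≈ (represents e x≈) x≈y = represents e (trans x≈ x≈y)

  ▷-0 : [] ▷ 0#
  ▷-0 = represents embed-0 refl

  ▷-1 : oneP ▷ 1#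
  ▷-1 = represents embed-1 refl

  ▷-add : ∀ {f g x y} → f ▷ x → g ▷ y → addP f g ▷ x + y
  ▷-add (represents ≡.refl x≈) (represents ≡.refl y≈) = represents (embed-+ _ _) (+-cong x≈ y≈)

  ▷-mul : ∀ {f g x y} → f ▷ x → g ▷ y → mulP f g ▷ x * y
  ▷-mul (represents ≡.refl x≈) (represents ≡.refl y≈) = represents (embed-* _ _) (*-cong x≈ y≈)

  ▷-neg : ∀ {f x} → f ▷ x → negP f ▷ - x
  ▷-neg (represents ≡.refl x≈) = represents (embed-neg _) (-‿cong x≈)

  ▷-pow : ∀ {f x} k → f ▷ x → powP f k ▷ x ^ k
  ▷-pow zero    f▷x = ▷-1
  ▷-pow (suc k) f▷x = ▷-mul f▷x (▷-pow k f▷x)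

  ▷-qpow : ∀ k → qpow k ▷ q ^ k
  ▷-qpow k = ▷-pow k (represents embed-q refl)

  ▷-const : ∀ m → constP (fromℕQ m) ▷ ι m
  ▷-const m with constant m
  ... | x , e , x≈ = represents e x≈

  ▷-bracket : ∀ m → bracket m ▷ [ m ]
  ▷-bracket m = ▷-≈ (sum-powers (upTo m)) (geometric m)
    where
    sum-powers : ∀ is → foldr addP [] (map qpow is) ▷ ∑ is (q ^_)
    sum-powers []       = ▷-0
    sum-powers (i ∷ is) = ▷-add (▷-qpow i) (sum-powers is)
    geometric : ∀ m → ∑ (upTo m) (q ^_) ≈ [ m ]
    geometric zero    = refl
    geometric (suc m) = +-congˡ (begin
      ∑ (applyUpTo suc m) (q ^_)       ≡⟨ ≡.cong (λ is → ∑ is (q ^_)) (List.map-upTo suc m) ⟨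
      ∑ (map suc (upTo m)) (q ^_)      ≈⟨ ∑-map suc (upTo m) _ ⟩
      ∑ (upTo m) (λ i → q * q ^ i)     ≈⟨ ∑-*ˡ (upTo m) q _ ⟨
      q * ∑ (upTo m) (q ^_)            ≈⟨ *-congˡ (geometric m) ⟩
      q * [ m ]                        ∎)

module Values (A : IntegralSubring) (r n : ℕ) where
  open IntegralSubring A
  private module A where
    open CommutativeRing integers public
    open Exp commutativeSemiring public
    open QBracket integers q public
    open BinomialSeries integers public using (ι)

  open PrincipalQuotient integers (A.[_] (suc r) A.^ n) public
  open CommutativeRing commutativeRing/ hiding (_≈_)
  open Representation A
  open Exp commutativeSemiring
  open QBracket commutativeRing/ q
  open Sums commutativeRing/
  open Chains commutativeRing/
  open BinomialSeries commutativeRing/ using (ι)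
  open import Relation.Binary.Reasoning.Setoid setoid
  open Solver commutativeSemiring using (solve; _:=_; _:+_; _:*_; con)

  -- Both rings have the same operations, but functions defined by recursion over
  -- the two bundles are not definitionally equal.
  ^≡ : ∀ x k → x A.^ k ≡ x ^ k
  ^≡ x zero    = ≡.refl
  ^≡ x (suc k) = ≡.cong (x *_) (^≡ x k)

  []≡ : ∀ m → A.[_] m ≡ [ m ]
  []≡ zero    = ≡.refl
  []≡ (suc m) = ≡.cong (λ b → 1# + q * b) ([]≡ m)

  ι≡ : ∀ m → A.ι m ≡ ι m
  ι≡ zero    = ≡.refl
  ι≡ (suc m) = ≡.cong (λ x → 1# + x) (ι≡ m)

  [p]^n~0 : [ suc r ] ^ n ~ 0#
  [p]^n~0 = trans (reflexive (≡.trans (≡.cong (_^ n) (≡.sym ([]≡ (suc r)))) (≡.sym (^≡ _ n)))) m~0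

  infix 4 _≙_
  record _≙_ (x : Frac) (v : Carrier) : Set where
    constructor value
    field
      {num den} : Carrier
      num▷      : proj₁ x ▷ num
      den▷      : proj₂ x ▷ den
      num~      : num ~ v * den

  ≙-~ : ∀ {x u v} → x ≙ u → u ~ v → x ≙ v
  ≙-~ (value a▷ b▷ a~) u~v = value a▷ b▷ (trans a~ (*-congʳ u~v))

  ≙-add : ∀ {x y u v} → x ≙ u → y ≙ v → addF x y ≙ u + v
  ≙-add {u = u} {v} (value {a} {b} a▷ b▷ a~) (value {c} {d} c▷ d▷ c~) =
    value (▷-add (▷-mul a▷ d▷) (▷-mul c▷ b▷)) (▷-mul b▷ d▷)
      (trans (+-cong (*-congʳ a~) (*-congʳ c~))
        (solve 4 (λ u v b d → u :* b :* d :+ v :* d :* b := (u :+ v) :* (b :* d)) refl u v b d))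

  ≙-mul : ∀ {x y u v} → x ≙ u → y ≙ v → mulF x y ≙ u * v
  ≙-mul {u = u} {v} (value {a} {b} a▷ b▷ a~) (value {c} {d} c▷ d▷ c~) =
    value (▷-mul a▷ c▷) (▷-mul b▷ d▷)
      (trans (*-cong a~ c~) (solve 4 (λ u v b d → (u :* b) :* (v :* d) := (u :* v) :* (b :* d)) refl u v b d))

  ≙-ofP : ∀ {f v} → f ▷ v → ofP f ≙ v
  ≙-ofP f▷v = value f▷v ▷-1 (sym (*-identityʳ _))

  ≙-pow : ∀ {x v} k → x ≙ v → powF x k ≙ v ^ k
  ≙-pow zero    x≙v = ≙-ofP ▷-1
  ≙-pow (suc k) x≙v = ≙-mul x≙v (≙-pow k x≙v)

  ≙-sum : ∀ {I : Set} {is : List I} {F V} → All (λ i → F i ≙ V i) is → sumF (map F is) ≙ ∑ is V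
  ≙-sum []       = ≙-ofP ▷-0
  ≙-sum (e ∷ es) = ≙-add e (≙-sum es)

  ≙-const : ∀ m → ofP (constP (fromℕQ m)) ≙ ι m
  ≙-const m = ≡.subst (_ ≙_) (ι≡ m) (≙-ofP (▷-const m))

  ▷-qpow/ : ∀ k → qpow k ▷ q ^ k
  ▷-qpow/ k = ≡.subst (_ ▷_) (^≡ q k) (▷-qpow k)

  ▷-bracket/ : ∀ m → bracket m ▷ [ m ]
  ▷-bracket/ m = ≡.subst (_ ▷_) ([]≡ m) (▷-bracket m)

  ▷-pow/ : ∀ {f x} k → f ▷ x → powP f k ▷ x ^ k
  ▷-pow/ {x = x} k f▷x = ≡.subst (_ ▷_) (^≡ x k) (▷-pow k f▷x)

  ▷-unique : ∀ {f g x y} → f ▷ x → g ▷ y → x A.≈ y → f ≈P g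
  ▷-unique (represents ≡.refl x≈) (represents ≡.refl y≈) x≈y = embed-cong (A.trans x≈ (A.trans x≈y (A.sym y≈)))

  -- With a common value `v`, both cross products equal `v` times the two denominators. The cofactor
  -- of the resulting congruence, embedded, is the integral quotient.
  EqMod-fromValues : Prime (suc r) → ∀ {x y u v} → x ≙ u → y ≙ v → u ~ v → EqMod (suc r) n x y
  EqMod-fromValues p-prime {x} {y} {u} {v} (value {a} {b} a▷ b▷ a~) (value {c} {d} c▷ d▷ c~) u~v =
    embed factor , embed-integral p-prime factor ,
    ▷-unique (▷-add (▷-mul a▷ d▷) (▷-neg (▷-mul c▷ b▷)))
             (▷-mul (▷-pow n (▷-bracket (suc r))) (represents ≡.refl A.refl))
             (A.trans equality (A.+-identityˡ _))
    where
    difference : a * d + - (c * b) ~ 0#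
    difference = begin
      a * d + - (c * b)      ≈⟨ +-congʳ (trans (*-congʳ (trans a~ (*-congʳ u~v))) (solve 3 (λ v b d → v :* b :* d := v :* d :* b) refl v b d)) ⟩
      v * d * b + - (c * b)  ≈⟨ +-congʳ (*-congʳ c~) ⟨
      c * b + - (c * b)      ≈⟨ -‿inverseʳ (c * b) ⟩
      0#                     ∎
    open _~_ difference

  open Duality commutativeRing/ q r using (InRange)

  module _ (c : ℕ → Carrier) (c-inverse : ∀ {j} → InRange j → [ j ] * c j ~ 1#) where

    ≙-summand : ∀ e k {j} → InRange j → (qpow e , powP (bracket j) k) ≙ q ^ e * c j ^ k
    ≙-summand e k {j} j∈ = value (▷-qpow/ e) (▷-pow/ k (▷-bracket/ j)) (sym (begin
      q ^ e * c j ^ k * [ j ] ^ k          ≈⟨ solve 3 (λ q c b → q :* c :* b := q :* (b :* c)) refl (q ^ e) (c j ^ k) ([ j ] ^ k) ⟩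
      q ^ e * ([ j ] ^ k * c j ^ k)        ≈⟨ *-congˡ (proj₂ (Units.^-unit commutativeRing/ k (c j , c-inverse j∈))) ⟩
      q ^ e * 1#                           ≈⟨ *-identityʳ _ ⟩
      q ^ e                                ∎))

    -- `Hgen` sums over the largest variable at once, while `chain` tests one candidate at a time
    -- from the top. The summand `j = suc m` is the branch in which the head of the list is used.
    chain-∑ : ∀ s φ φs m → ∑ (map suc (upTo m)) (λ j → φ j * chain s (applyDownFrom suc (if s then j else j ∸ 1)) φs) ~
                           chain s (applyDownFrom suc m) (φ ∷ φs)
    chain-∑ s φ φs zero = refl
    chain-∑ s φ φs (suc m) = begin
      ∑ (map suc (upTo (suc m))) F             ≈⟨ ∑-map suc (upTo (suc m)) F ⟩
      ∑ (upTo (suc m)) (F ∘ suc)               ≈⟨ ∑-upTo-suc m (F ∘ suc) ⟩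
      ∑ (upTo m) (F ∘ suc) + F (suc m)         ≈⟨ +-comm _ _ ⟩
      F (suc m) + ∑ (upTo m) (F ∘ suc)         ≈⟨ +-cong (reflexive (≡.cong (λ L → φ (suc m) * chain s L φs) (if-down s))) (trans (sym (∑-map suc (upTo m) F)) (chain-∑ s φ φs m)) ⟩
      chain s (applyDownFrom suc (suc m)) (φ ∷ φs) ∎
      where
      F = λ j → φ j * chain s (applyDownFrom suc (if s then j else j ∸ 1)) φs
      if-down : ∀ s → applyDownFrom suc (if s then suc m else m) ≡ (if s then suc m ∷ applyDownFrom suc m else applyDownFrom suc m)
      if-down false = ≡.refl
      if-down true  = ≡.refl

    -- Keeping the exponent `e` general treats `H` and `Hbar` together. The bound `m ≤ r` descends
    -- to the inner sums and keeps every bracket invertible.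
    ≙-Hgen : ∀ e s ks {m} → m ≤ r → Hgen e s m ks ≙ chain s (applyDownFrom suc m) (map (λ k j → q ^ e k j * c j ^ k) ks)
    ≙-Hgen e s []       m≤r = ≙-ofP ▷-1
    ≙-Hgen e s (k ∷ ks) {m} m≤r = ≙-~ (≙-sum summands) (chain-∑ s (φ k) (map φ ks) m)
      where
      φ : ℕ → ℕ → Carrier
      φ k j = q ^ e k j * c j ^ k
      previous : ℕ → ℕ
      previous j = if s then j else j ∸ 1
      previous≤ : ∀ s j → (if s then j else j ∸ 1) ≤ j
      previous≤ false j = ℕ.m∸n≤m j 1
      previous≤ true  j = ℕ.≤-refl
      F : ℕ → Frac
      F j = mulF (qpow (e k j) , powP (bracket j) k) (Hgen e s (previous j) ks)
      V : ℕ → Carrier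
      V j = φ k j * chain s (applyDownFrom suc (previous j)) (map φ ks)
      summand : ∀ {i} → i < m → F (suc i) ≙ V (suc i)
      summand {i} i<m = ≙-mul (≙-summand (e k (suc i)) k (s≤s z≤n , i<r))
                              (≙-Hgen e s ks (ℕ.≤-trans (previous≤ s (suc i)) i<r))
        where
        i<r : i < r
        i<r = ℕ.≤-trans i<m m≤r
      summands : All (λ j → F j ≙ V j) (map suc (upTo m))
      summands = ≡.subst (All (λ j → F j ≙ V j)) (≡.sym (List.map-upTo suc m)) (applyUpTo⁺₁ suc m summand)

-- The congruence at each prime, and the theorem.

-- The values are assembled along the syntax of `Hbar` and `RHS`, so that they are the two sides of
-- `chain-duality`.
duality : IntegralSubring → ∀ s k → All (1 ≤_) k → ∀ n M → n ≤ M → ∀ r → Prime (suc r) →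
          EqMod (suc r) n (Hbar s r k) (RHS s k (suc r) (suc M))
duality A s k 1≤k n M n≤M r p-prime =
  EqMod-fromValues p-prime (≙-Hgen c c-inverse (λ k j → j) s k ℕ.≤-refl)
    (≙-mul (≙-pow (wt k) (value (▷-neg ▷-1) (▷-qpow/ p) -Q))
      (≙-mul (≙-pow (dep k) (≙-ofP (▷-qpow/ p)))
        (≙-sum (All.universal
          (λ l → ≙-mul (≙-pow (wt l) (≙-mul (value ▷-1 (▷-qpow/ p) 1Q) (≙-ofP (▷-bracket/ p))))
                   (≙-mul (≙-const (bbin k l)) (≙-Hgen c c-inverse (λ k j → (k ∸ 1) ℕ.* j) s (reverse (zipWith ℕ._+_ k l)) ℕ.≤-refl)))
          (lowWt (dep k) (suc M))))))
    (chain-duality Q c Q-inverse c-inverse M w-nilpotent s k 1≤k)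
  where
  open IntegralSubring A using (q)
  open Representation A
  open Values A r n
  open CommutativeRing commutativeRing/ hiding (_≈_)
  open Exp commutativeSemiring
  open BracketUnits commutativeRing/ q r n
  open Duality commutativeRing/ q r
  open QBracket commutativeRing/ q
  Q = proj₁ (q^p-unit [p]^n~0)
  c = λ j → proj₁ ([]-inverse [p]^n~0 p-prime j)
  c-inverse : ∀ {j} → InRange j → [ j ] * c j ~ 1#
  c-inverse {j} = proj₂ ([]-inverse [p]^n~0 p-prime j)
  Q-inverse : Q * q ^ p ~ 1#
  Q-inverse = trans (*-comm Q (q ^ p)) (proj₂ (q^p-unit [p]^n~0))
  w-nilpotent : (Q * [ p ]) ^ suc M ~ 0#
  w-nilpotent = Powers.^-zero-mono commutativeRing/ (multiple-nilpotent [p]^n~0 Q) (ℕ.m≤n⇒m≤1+n n≤M)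
  -Q : - 1# ~ - 1# * Q * q ^ p
  -Q = sym (trans (*-assoc (- 1#) Q (q ^ p)) (trans (*-congˡ Q-inverse) (*-identityʳ (- 1#))))
  1Q : 1# ~ Q * q ^ p
  1Q = sym Q-inverse

theorem5p1 : (s : Bool) (k : List ℕ) → All (1 ≤_) k → (n : ℕ) →
    ∃[ N₀ ] (∀ N → N₀ ≤ N →
    ∃[ P₀ ] (∀ p → Prime p → P₀ ≤ p →
    EqMod p n (Hbar s (p ∸ 1) k) (RHS s k p N)))
-- Any `N` from `suc n` on is `suc M` with `n ≤ M`, so the omitted weights vanish modulo `[ p ]ⁿ`.
-- The congruence holds at every prime, hence the threshold 0 for `p`.
theorem5p1 s k 1≤k n = suc n , λ { (suc M) (s≤s n≤M) → 0 , λ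
  { zero    p-prime _ → contradiction p-prime ¬prime[0]
  ; (suc r) p-prime _ → duality ℤ[q]⊂ℚ[q] s k 1≤k n M n≤M r p-prime } }
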